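{- Let $\mathcal{C}$ be the set of integer partitions in which, for every positive integer $i$, none of the following occurs as a sub-partition: $i+(i+1)+(i+1)$; $i+i+(i+1)$; $i+(i+2)+(i+2)+(i+2)$; $i+i+i+(i+2)$; $i+i+i+i$. Let $\mathcal{P}_7$ be the set of $\pi\in\mathcal{C}$ in which neither $1+1$ nor $2+2+2$ occurs as a sub-partition, and let $\mathcal{P}_{7a}$ be the set of $\pi\in\mathcal{C}$ all of whose parts are at least $3$. Then, as formal power series in $x,q$, writing $M=i+2j+3k+4l$, $$\sum_{\pi\in\mathcal{P}_7}x^{\ell(\pi)}q^{|\pi|}=\sum_{i,j,k,l\ge 0}(-1)^l\frac{x^{M}q^{\frac{M(M-1)}{2}+2l^2+i+3j+6k+6l}}{(q;q)_i\,(q^2;q^2)_j\,(q^3;q^3)_k\,(q^4;q^4)_l},$$ $$\sum_{\pi\in\mathcal{P}_{7a}}x^{\ell(\pi)}q^{|\pi|}=\sum_{i,j,k,l\ge 0}(-1)^l\frac{x^{M}q^{\frac{M(M-1)}{2}+2l^2+3i+5j+6k+10l}}{(q;q)_i\,(q^2;q^2)_j\,(q^3;q^3)_k\,(q^4;q^4)_l}.$$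
   Context: Partitions are finite weakly increasing sequences of positive integers (the empty partition is included); $\ell(\pi)$ is the number of parts and $|\pi|$ the sum of the parts of $\pi$. A sub-partition of a partition is a contiguous portion of it. For $n\ge 0$, $(a;q)_n=\prod_{0\le t<n}(1-aq^t)$. All identities are identities of formal power series. -}

module Defs where

open import Data.Bool using (if_then_else_)
open import Data.Empty using (⊥-elim)
open import Data.Integer as ℤ using (ℤ; 0ℤ; 1ℤ)
import Data.Integer.Properties as ℤₚ
open import Data.List using (List; []; _∷_; foldr; map; filter; applyUpTo; applyDownFrom)
open import Data.List.Membership.Propositional using (_∈_)
open import Data.List.Membership.Propositional.Properties using (∈-filter⁺; ∈-filter⁻)
open import Data.List.Membership.Propositional.Properties.WithK using (unique∧set⇒bag)
open import Data.List.Relation.Binary.BagAndSetEquality using (∼bag⇒↭)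
open import Data.List.Relation.Binary.Infix.Heterogeneous using (Infix)
open import Data.List.Relation.Binary.Permutation.Propositional using (_↭_; ↭⇒↭ₛ)
open import Data.List.Relation.Binary.Permutation.Propositional.Properties using (map⁺)
open import Data.List.Relation.Binary.Permutation.Setoid.Properties using (foldr-commMonoid)
open import Data.List.Relation.Unary.All as All using (All)
open import Data.List.Relation.Unary.Linked using (Linked)
open import Data.List.Relation.Unary.Unique.Propositional using (Unique)
open import Data.List.Relation.Unary.Unique.Propositional.Properties using (filter⁺)
open import Data.Nat using (ℕ; zero; suc; _+_; _∸_; _≤_; _≡ᵇ_)
open import Data.Product using (∃; _×_; _,_)
open import Function using (_∘_; mk⇔)
open import Relation.Binary.PropositionalEquality
open import Relation.Nullary using (¬_; Dec; yes; no; ¬?)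

IsPartition : List ℕ → Set
IsPartition π = All (1 ≤_) π × Linked _≤_ π

_⊑_ : List ℕ → List ℕ → Set
_⊑_ = Infix _≡_

infix 4 _⊑_

𝒞 : List ℕ → Set
𝒞 π = IsPartition π × (∀ i → 1 ≤ i →
    ¬ (i ∷ suc i ∷ suc i ∷ [] ⊑ π)
  × ¬ (i ∷ i ∷ suc i ∷ [] ⊑ π)
  × ¬ (i ∷ 2 + i ∷ 2 + i ∷ 2 + i ∷ [] ⊑ π)
  × ¬ (i ∷ i ∷ i ∷ 2 + i ∷ [] ⊑ π)
  × ¬ (i ∷ i ∷ i ∷ i ∷ [] ⊑ π))

𝒫₇ : List ℕ → Set
𝒫₇ π = 𝒞 π × ¬ (1 ∷ 1 ∷ [] ⊑ π) × ¬ (2 ∷ 2 ∷ 2 ∷ [] ⊑ π)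

𝒫₇ₐ : List ℕ → Set
𝒫₇ₐ π = 𝒞 π × All (3 ≤_) π

sumℤ : List ℤ → ℤ
sumℤ = foldr ℤ._+_ 0ℤ

-- `f n` is the coefficient of qⁿ.
ℤ⟦q⟧ : Set
ℤ⟦q⟧ = ℕ → ℤ

-- `F m n` is the coefficient of xᵐqⁿ.
ℤ⟦x,q⟧ : Set
ℤ⟦x,q⟧ = ℕ → ℤ⟦q⟧

infix  9 q^_
infixr 8 _^ₛ_
infixl 7 _⊛_ _⊘_
infixr 8 _·_
infixl 6 _⊖_
infixr 5 x^_·_

q^_ : ℕ → ℤ⟦q⟧
(q^ e) n = if n ≡ᵇ e then 1ℤ else 0ℤ

one : ℤ⟦q⟧
one = q^ 0

_⊖_ : ℤ⟦q⟧ → ℤ⟦q⟧ → ℤ⟦q⟧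
(f ⊖ g) n = f n ℤ.- g n

_·_ : ℤ → ℤ⟦q⟧ → ℤ⟦q⟧
(c · f) n = c ℤ.* f n

_⊛_ : ℤ⟦q⟧ → ℤ⟦q⟧ → ℤ⟦q⟧
(f ⊛ g) n = sumℤ (applyUpTo (λ k → f k ℤ.* g (n ∸ k)) (suc n))

_^ₛ_ : ℤ⟦q⟧ → ℕ → ℤ⟦q⟧
f ^ₛ zero  = one
f ^ₛ suc n = f ⊛ f ^ₛ n

-- The reciprocal g of a series f with constant term 1 (meaningless for other
-- f), by g₀ = 1 and gₙ = - (f₁ gₙ₋₁ + f₂ gₙ₋₂ + ⋯ + fₙ g₀) for n ≥ 1.
-- `recips f n` is the list gₙ₋₁ , … , g₀. See `⊛-recip`.

dot : (ℕ → ℤ) → List ℤ → ℤ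
dot f []       = 0ℤ
dot f (c ∷ cs) = f 0 ℤ.* c ℤ.+ dot (f ∘ suc) cs

nextRecip : ℤ⟦q⟧ → List ℤ → ℤ
nextRecip f []          = 1ℤ
nextRecip f cs@(_ ∷ _)  = ℤ.- dot (f ∘ suc) cs

recips : ℤ⟦q⟧ → ℕ → List ℤ
recips f zero    = []
recips f (suc n) = nextRecip f (recips f n) ∷ recips f n

recip : ℤ⟦q⟧ → ℤ⟦q⟧
recip f n = nextRecip f (recips f n)

_⊘_ : ℤ⟦q⟧ → ℤ⟦q⟧ → ℤ⟦q⟧
f ⊘ g = f ⊛ recip g

-- poch a b n is (a;b)ₙ.
poch : ℤ⟦q⟧ → ℤ⟦q⟧ → ℕ → ℤ⟦q⟧
poch a b zero    = one
poch a b (suc n) = poch a b n ⊛ (one ⊖ a ⊛ b ^ₛ n)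

x^_·_ : ℕ → ℤ⟦q⟧ → ℤ⟦x,q⟧
(x^ M · f) m n = if m ≡ᵇ M then f n else 0ℤ

-- Formal sum of the family F over the indices i satisfying P: for each
-- monomial xᵐqⁿ only finitely many terms contribute, and their coefficients
-- add up to that of S. The list may also contain indices that contribute 0;
-- this does not affect the value (`HasSum-unique`).
HasSum : {I : Set} → (I → Set) → (I → ℤ⟦x,q⟧) → ℤ⟦x,q⟧ → Set
HasSum {I} P F S = ∀ m n → ∃ λ is →
    Unique is
  × All P is
  × (∀ i → P i → F i m n ≢ 0ℤ → i ∈ is)
  × sumℤ (map (λ i → F i m n) is) ≡ S m n

dot-applyDownFrom : ∀ f g n → dot f (applyDownFrom g (suc n)) ≡ (f ⊛ g) n
dot-applyDownFrom f g zero    = refl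
dot-applyDownFrom f g (suc n) =
  cong (λ a → f 0 ℤ.* g (suc n) ℤ.+ a) (dot-applyDownFrom (f ∘ suc) g n)

recips≡ : ∀ f n → recips f n ≡ applyDownFrom (recip f) n
recips≡ f zero    = refl
recips≡ f (suc n) = cong (recip f n ∷_) (recips≡ f n)

⊛-recip : ∀ f → f 0 ≡ 1ℤ → ∀ n → (f ⊛ recip f) n ≡ one n
⊛-recip f f₀ zero    rewrite f₀ = refl
⊛-recip f f₀ (suc n) = begin
  f 0 ℤ.* recip f (suc n) ℤ.+ ((f ∘ suc) ⊛ recip f) n
    ≡⟨ cong₂ (λ a b → a ℤ.* recip f (suc n) ℤ.+ b) f₀ (sym tail≡) ⟩
  1ℤ ℤ.* recip f (suc n) ℤ.+ d
    ≡⟨ cong (λ a → a ℤ.+ d) (ℤₚ.*-identityˡ (recip f (suc n))) ⟩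
  ℤ.- d ℤ.+ d
    ≡⟨ ℤₚ.+-inverseˡ d ⟩
  0ℤ ∎
  where
  open ≡-Reasoning
  d = dot (f ∘ suc) (recips f (suc n))
  tail≡ : d ≡ ((f ∘ suc) ⊛ recip f) n
  tail≡ = trans (cong (dot (f ∘ suc)) (recips≡ f (suc n)))
                (dot-applyDownFrom (f ∘ suc) (recip f) n)

⊛-const : ∀ f g → f 0 ≡ 1ℤ → g 0 ≡ 1ℤ → (f ⊛ g) 0 ≡ 1ℤ
⊛-const f g f₀ g₀ rewrite f₀ | g₀ = refl

poch-const : ∀ s b n → poch (q^ suc s) b n 0 ≡ 1ℤ
poch-const s b zero    = refl
poch-const s b (suc n) =
  ⊛-const (poch (q^ suc s) b n) (one ⊖ q^ suc s ⊛ b ^ₛ n) (poch-const s b n) refl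

private
  sumℤ-↭ : ∀ {xs ys} → xs ↭ ys → sumℤ xs ≡ sumℤ ys
  sumℤ-↭ p = foldr-commMonoid (setoid ℤ) ℤₚ.+-0-isCommutativeMonoid (↭⇒↭ₛ p)

  module _ {I : Set} (c : I → ℤ) where

    nonZero? : ∀ i → Dec (c i ≢ 0ℤ)
    nonZero? i = ¬? (c i ℤ.≟ 0ℤ)

    sum-filter : ∀ is → sumℤ (map c (filter nonZero? is)) ≡ sumℤ (map c is)
    sum-filter [] = refl
    sum-filter (i ∷ is) with c i ℤ.≟ 0ℤ
    ... | no  _   = cong (λ a → c i ℤ.+ a) (sum-filter is)
    ... | yes c≡0 rewrite c≡0 = trans (sum-filter is) (sym (ℤₚ.+-identityˡ _))

    sum-unique : (P : I → Set) → ∀ {is js} → Unique is → All P is → Unique js → All P js →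
      (∀ i → P i → c i ≢ 0ℤ → i ∈ is) → (∀ i → P i → c i ≢ 0ℤ → i ∈ js) →
      sumℤ (map c is) ≡ sumℤ (map c js)
    sum-unique P {is} {js} uᵢ pᵢ uⱼ pⱼ coverᵢ coverⱼ =
      trans (sym (sum-filter is)) (trans (sumℤ-↭ (map⁺ c (∼bag⇒↭
        (unique∧set⇒bag (filter⁺ nonZero? uᵢ) (filter⁺ nonZero? uⱼ)
          (mk⇔ (to pᵢ coverⱼ) (to pⱼ coverᵢ)))))) (sum-filter js))
      where
      to : ∀ {is js i} → All P is → (∀ i → P i → c i ≢ 0ℤ → i ∈ js) →
           i ∈ filter nonZero? is → i ∈ filter nonZero? js
      to {i = i} ps cover i∈ with ∈-filter⁻ nonZero? i∈
      ... | i∈is , ci≢0 = ∈-filter⁺ nonZero? (cover i (All.lookup ps i∈is) ci≢0) ci≢0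

HasSum-unique : {I : Set} (P : I → Set) (F : I → ℤ⟦x,q⟧) {S T : ℤ⟦x,q⟧} →
                HasSum P F S → HasSum P F T → ∀ m n → S m n ≡ T m n
HasSum-unique P F hS hT m n with hS m n | hT m n
... | is , uᵢ , pᵢ , coverᵢ , sumᵢ | js , uⱼ , pⱼ , coverⱼ , sumⱼ =
  trans (sym sumᵢ) (trans (sum-unique (λ i → F i m n) P uᵢ pᵢ uⱼ pⱼ coverᵢ coverⱼ) sumⱼ)

{-# OPTIONS --safe #-}
-- Subtract t from the t-th part (t = 0, 1, …) of a partition in 𝒞 with M parts:
-- this costs q^(M(M-1)/2) and leaves a word whose maximal runs of steps -1 are
-- Sₐ = a, Dₐ = (a+1, a) or Tₐ = (a+2, a+1, a). The conditions of 𝒞 say exactly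
-- that the runs increase weakly in the order S₁ < D₁ < T₁ < S₂ < ⋯ and that Tₐ
-- and Sₐ₊₁ do not both occur. Writing Sₐ, … also for the monomials in x and q of
-- these runs, the words from level a on have the generating function
--   ∏ (1 - T_b S_{b+1}) / ((1 - S_b) (1 - D_b) (1 - T_b))   over b ≥ a,
-- and Euler's expansions of its four factors are the sums over l, i, j and k.
-- Here both sides are compared through their recurrences in a: for partitions,
-- by splitting off the first run; for the quadruple sums, by
-- 1/(q;q)ᵢ - qⁱ/(q;q)ᵢ = 1/(q;q)ᵢ₋₁ and its analogues for j, k and l.
module Submission where

open import Defs
open import Algebra.Bundles using (CommutativeMonoid)
import Algebra.Properties.CommutativeSemigroup as CommutativeSemigroupProperties
open import Algebra.Structures.Biased using (isCommutativeMonoidˡ)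
open import Data.Bool as Bool using (true; false)
open import Data.Integer as ℤ using (ℤ; 0ℤ; 1ℤ; -1ℤ) renaming (_^_ to _^ℤ_)
import Data.Integer.Properties as ℤₚ
open import Algebra.Properties.AbelianGroup ℤₚ.+-0-abelianGroup using ()
  renaming (∙-cancelʳ to +-cancelʳ)
open import Data.Integer.Tactic.RingSolver using () renaming (solve-∀ to ℤ-solve-∀)
open import Data.List using (List; []; _∷_; _++_; map; replicate; length; upTo; applyUpTo; cartesianProduct)
open import Data.List.Membership.Propositional using (_∈_)
open import Data.List.Membership.Propositional.Properties
  using (∈-++⁺ˡ; ∈-++⁺ʳ; ∈-map⁺; ∈-map⁻; ∈-cartesianProduct⁺; ∈-upTo⁺)
open import Data.List.Properties
  using (map-upTo; map-applyUpTo; map-∘; length-++; length-replicate; ++-cancelˡ)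
open import Data.List.Relation.Binary.Disjoint.Propositional using (Disjoint)
open import Data.List.Relation.Binary.Infix.Heterogeneous using (here; there)
open import Data.List.Relation.Binary.Prefix.Heterogeneous using (Prefix; []; _∷_)
open import Data.List.Relation.Binary.Prefix.Heterogeneous.Properties using (prefix?)
open import Data.List.Relation.Unary.All as All using (All; []; _∷_)
import Data.List.Relation.Unary.All.Properties as Allₚ
import Data.List.Relation.Unary.AllPairs as AllPairs
open import Data.List.Relation.Unary.Any using (here)
open import Data.List.Relation.Unary.Linked as Linked using (Linked; []; [-]; _∷_)
open import Data.List.Relation.Unary.Linked.Properties using (Linked⇒All)
open import Data.List.Relation.Unary.Unique.Propositional using (Unique)
import Data.List.Relation.Unary.Unique.Propositional.Properties as Uniqueₚ
open import Data.Nat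
  using (ℕ; zero; suc; _+_; _*_; _∸_; _^_; _/_; _≤_; _<_; z≤n; s≤s; _≟_; _≡ᵇ_)
open import Data.Nat.DivMod using (+-distrib-/-∣ˡ; m*n/n≡m)
open import Data.Nat.Divisibility using (divides-refl)
open import Data.Nat.ListAction using (sum)
open import Data.Nat.ListAction.Properties using (sum-++)
import Data.Nat.Properties as ℕₚ
open import Data.Nat.Tactic.RingSolver using (solve-∀)
open import Data.Product using (∃; _×_; _,_; proj₁; proj₂)
open import Data.Sum using (inj₁; inj₂)
open import Function using (_∘_; id)
open import Relation.Binary.Bundles using (Setoid)
open import Relation.Binary.PropositionalEquality
open import Relation.Nullary using (¬_; yes; no; contradiction)
open import Relation.Unary using (U)

-- The ring of power series in q

-- Sums and scalar multiples in one operation, so that a single induction gives the linearity of `⊛`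
-- in its first factor; c = -1 gives differences.
scale-add : ℤ → ℤ⟦q⟧ → ℤ⟦q⟧ → ℤ⟦q⟧
scale-add c f g n = c ℤ.* f n ℤ.+ g n

-- By computation, coefficient n + 1 of `f ⊛ g` is f₀ gₙ₊₁ plus coefficient n of `(f ∘ suc) ⊛ g`.
-- The inductions on `⊛` use this unfolding.
⊛-cong : ∀ {f f′ g g′} → f ≗ f′ → g ≗ g′ → f ⊛ g ≗ f′ ⊛ g′
⊛-cong p r zero    = cong₂ (λ a b → a ℤ.* b ℤ.+ 0ℤ) (p 0) (r 0)
⊛-cong p r (suc n) =
  cong₂ ℤ._+_ (cong₂ ℤ._*_ (p 0) (r (suc n))) (⊛-cong (p ∘ suc) r n)

⊛-scale-addˡ : ∀ c f g h → scale-add c f g ⊛ h ≗ scale-add c (f ⊛ h) (g ⊛ h)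
⊛-scale-addˡ c f g h zero = lemma c (f 0) (g 0) (h 0)
  where
  lemma : ∀ c f g h → (c ℤ.* f ℤ.+ g) ℤ.* h ℤ.+ 0ℤ ≡ c ℤ.* (f ℤ.* h ℤ.+ 0ℤ) ℤ.+ (g ℤ.* h ℤ.+ 0ℤ)
  lemma = ℤ-solve-∀
⊛-scale-addˡ c f g h (suc n) =
  trans (cong (λ z → (c ℤ.* f 0 ℤ.+ g 0) ℤ.* h (suc n) ℤ.+ z)
              (⊛-scale-addˡ c (f ∘ suc) (g ∘ suc) h n))
        (lemma c (f 0) (g 0) (h (suc n)) (((f ∘ suc) ⊛ h) n) (((g ∘ suc) ⊛ h) n))
  where
  lemma : ∀ c f g h u v → (c ℤ.* f ℤ.+ g) ℤ.* h ℤ.+ (c ℤ.* u ℤ.+ v)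
                        ≡ c ℤ.* (f ℤ.* h ℤ.+ u) ℤ.+ (g ℤ.* h ℤ.+ v)
  lemma = ℤ-solve-∀

-- The mirror image of the unfolding of `⊛`, taking apart the second factor; commutativity compares
-- the two.
⊛-sucʳ : ∀ f g n → (f ⊛ g) (suc n) ≡ (f ⊛ (g ∘ suc)) n ℤ.+ f (suc n) ℤ.* g 0
⊛-sucʳ f g zero = lemma (f 0 ℤ.* g 1) (f 1 ℤ.* g 0)
  where
  lemma : ∀ a b → a ℤ.+ (b ℤ.+ 0ℤ) ≡ (a ℤ.+ 0ℤ) ℤ.+ b
  lemma = ℤ-solve-∀
⊛-sucʳ f g (suc n) =
  trans (cong (λ z → f 0 ℤ.* g (2 + n) ℤ.+ z) (⊛-sucʳ (f ∘ suc) g n))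
        (sym (ℤₚ.+-assoc (f 0 ℤ.* g (2 + n)) _ _))

⊛-comm : ∀ f g → f ⊛ g ≗ g ⊛ f
⊛-comm f g zero    = cong (ℤ._+ 0ℤ) (ℤₚ.*-comm (f 0) (g 0))
⊛-comm f g (suc n) =
  trans (ℤₚ.+-comm (f 0 ℤ.* g (suc n)) _)
    (trans (cong₂ ℤ._+_ (⊛-comm (f ∘ suc) g n) (ℤₚ.*-comm (f 0) (g (suc n))))
      (sym (⊛-sucʳ g f n)))

⊛-assoc : ∀ f g h → (f ⊛ g) ⊛ h ≗ f ⊛ (g ⊛ h)
⊛-assoc f g h zero    = lemma (f 0) (g 0) (h 0)
  where
  lemma : ∀ a b c → (a ℤ.* b ℤ.+ 0ℤ) ℤ.* c ℤ.+ 0ℤ ≡ a ℤ.* (b ℤ.* c ℤ.+ 0ℤ) ℤ.+ 0ℤ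
  lemma = ℤ-solve-∀
⊛-assoc f g h (suc n) =
  trans (cong (λ z → (f 0 ℤ.* g 0 ℤ.+ 0ℤ) ℤ.* h (suc n) ℤ.+ z)
          (trans (⊛-scale-addˡ (f 0) (g ∘ suc) ((f ∘ suc) ⊛ g) h n)
                 (cong (λ z → f 0 ℤ.* ((g ∘ suc) ⊛ h) n ℤ.+ z) (⊛-assoc (f ∘ suc) g h n))))
        (lemma (f 0) (g 0) (h (suc n)) (((g ∘ suc) ⊛ h) n) (((f ∘ suc) ⊛ (g ⊛ h)) n))
  where
  lemma : ∀ a b c u v → (a ℤ.* b ℤ.+ 0ℤ) ℤ.* c ℤ.+ (a ℤ.* u ℤ.+ v) ≡ a ℤ.* (b ℤ.* c ℤ.+ u) ℤ.+ v
  lemma = ℤ-solve-∀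

-- This is multiplication by qᵉ in a form that computes; `q^⊛` ties it to `⊛`.
shift : ℕ → ℤ⟦q⟧ → ℤ⟦q⟧
shift zero    f n       = f n
shift (suc e) f zero    = 0ℤ
shift (suc e) f (suc n) = shift e f n

-- Agreement is asked only at the index that the shift reads, so its proof may use e + k ≡ n. This
-- is how bounds on degrees reach the inner coefficients.
shift-cong : ∀ e {f g} n → (∀ k → e + k ≡ n → f k ≡ g k) → shift e f n ≡ shift e g n
shift-cong zero    n       p = p n refl
shift-cong (suc e) zero    p = refl
shift-cong (suc e) (suc n) p = shift-cong e n (λ k e+k≡n → p k (cong suc e+k≡n))

shift-shift : ∀ d e f n → shift d (shift e f) n ≡ shift (d + e) f n
shift-shift zero    e f n       = refl
shift-shift (suc d) e f zero    = refl
shift-shift (suc d) e f (suc n) = shift-shift d e f n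

shift-zero : ∀ e n → shift e (λ _ → 0ℤ) n ≡ 0ℤ
shift-zero zero    n       = refl
shift-zero (suc e) zero    = refl
shift-zero (suc e) (suc n) = shift-zero e n

shift-< : ∀ {e} f {n} → n < e → shift e f n ≡ 0ℤ
shift-< {suc e} f {zero}  _         = refl
shift-< {suc e} f {suc n} (s≤s n<e) = shift-< f n<e

shift-+ : ∀ e f g n → shift e (λ k → f k ℤ.+ g k) n ≡ shift e f n ℤ.+ shift e g n
shift-+ zero    f g n       = refl
shift-+ (suc e) f g zero    = refl
shift-+ (suc e) f g (suc n) = shift-+ e f g n

shift-· : ∀ e c f n → shift e (c · f) n ≡ c ℤ.* shift e f n
shift-· zero    c f n       = refl
shift-· (suc e) c f zero    = sym (ℤₚ.*-zeroʳ c)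
shift-· (suc e) c f (suc n) = shift-· e c f n

zero-⊛ : ∀ f n → ((λ _ → 0ℤ) ⊛ f) n ≡ 0ℤ
zero-⊛ f zero    = refl
zero-⊛ f (suc n) = trans (ℤₚ.+-identityˡ _) (zero-⊛ f n)

q^⊛ : ∀ e f → q^ e ⊛ f ≗ shift e f
q^⊛ zero    f zero    = trans (ℤₚ.+-identityʳ _) (ℤₚ.*-identityˡ _)
q^⊛ zero    f (suc n) =
  trans (cong₂ ℤ._+_ (ℤₚ.*-identityˡ (f (suc n))) (zero-⊛ f n)) (ℤₚ.+-identityʳ (f (suc n)))
q^⊛ (suc e) f zero    = refl
q^⊛ (suc e) f (suc n) = trans (ℤₚ.+-identityˡ _) (q^⊛ e f n)

q^-shift : ∀ d e n → shift d (q^ e) n ≡ (q^ (d + e)) n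
q^-shift zero    e n       = refl
q^-shift (suc d) e zero    = refl
q^-shift (suc d) e (suc n) = q^-shift d e n

q^-^ₛ : ∀ w n → (q^ w) ^ₛ n ≗ q^ (n * w)
q^-^ₛ w zero    m = refl
q^-^ₛ w (suc n) m = trans (q^⊛ w _ m) (trans (shift-cong w m (λ k _ → q^-^ₛ w n k)) (q^-shift w (n * w) m))

⊛-commutativeMonoid : CommutativeMonoid _ _
⊛-commutativeMonoid = record
  { Carrier = ℤ⟦q⟧
  ; _≈_     = _≗_
  ; _∙_     = _⊛_
  ; ε       = one
  ; isCommutativeMonoid = isCommutativeMonoidˡ record
    { isSemigroup = record
      { isMagma = record { isEquivalence = Setoid.isEquivalence (ℕ →-setoid ℤ) ; ∙-cong = ⊛-cong }
      ; assoc   = ⊛-assoc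
      }
    ; identityˡ = q^⊛ 0
    ; comm      = ⊛-comm
    }
  }

open CommutativeMonoid ⊛-commutativeMonoid using (commutativeSemigroup; identityʳ; identityˡ)
  renaming (setoid to ≗-setoid)
open CommutativeSemigroupProperties commutativeSemigroup using (xy∙z≈xz∙y; x∙yz≈y∙xz)

-- Write 1 as g (1/g), replace g by f u and cancel f against its reciprocal.
recip-⊛ : ∀ {f g} u → f 0 ≡ 1ℤ → g 0 ≡ 1ℤ → g ≗ f ⊛ u → recip f ≗ u ⊛ recip g
recip-⊛ {f} {g} u f₀ g₀ g≗fu = begin
  recip f                       ≈⟨ identityʳ _ ⟨
  recip f ⊛ one                 ≈⟨ ⊛-cong {recip f} (λ _ → refl) (⊛-recip g g₀) ⟨
  recip f ⊛ (g ⊛ recip g)       ≈⟨ ⊛-cong {recip f} (λ _ → refl) (⊛-cong {g′ = recip g} g≗fu (λ _ → refl)) ⟩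
  recip f ⊛ (f ⊛ u ⊛ recip g)   ≈⟨ ⊛-cong {recip f} (λ _ → refl) (⊛-assoc f u (recip g)) ⟩
  recip f ⊛ (f ⊛ (u ⊛ recip g)) ≈⟨ x∙yz≈y∙xz (recip f) f (u ⊛ recip g) ⟩
  f ⊛ (recip f ⊛ (u ⊛ recip g)) ≈⟨ ⊛-assoc f (recip f) (u ⊛ recip g) ⟨
  f ⊛ recip f ⊛ (u ⊛ recip g)   ≈⟨ ⊛-cong {g′ = u ⊛ recip g} (⊛-recip f f₀) (λ _ → refl) ⟩
  one ⊛ (u ⊛ recip g)           ≈⟨ identityˡ _ ⟩
  u ⊛ recip g                   ∎
  where open import Relation.Binary.Reasoning.Setoid ≗-setoid

-- This is (1 - qʰ)/D′ = 1/D, rearranged without subtraction. All recurrences of the quadruple sums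
-- come from it, with D′ the denominator after one index has gone up.
recip-step : ∀ {D D′} h → D 0 ≡ 1ℤ → D′ 0 ≡ 1ℤ → D′ ≗ D ⊛ (one ⊖ q^ h) →
             ∀ n → recip D′ n ≡ shift h (recip D′) n ℤ.+ recip D n
recip-step {D} {D′} h D₀ D′₀ D′≗ n = begin
  r                  ≡⟨ lemma r s ⟩
  s ℤ.+ (-1ℤ ℤ.* s ℤ.+ r) ≡⟨ cong (ℤ._+_ s) (cong₂ (λ a b → -1ℤ ℤ.* a ℤ.+ b) (q^⊛ h (recip D′) n) (q^⊛ 0 (recip D′) n)) ⟨
  s ℤ.+ scale-add -1ℤ (q^ h ⊛ recip D′) (one ⊛ recip D′) n
                     ≡⟨ cong (ℤ._+_ s) (⊛-scale-addˡ -1ℤ (q^ h) one (recip D′) n) ⟨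
  s ℤ.+ (scale-add -1ℤ (q^ h) one ⊛ recip D′) n
                     ≡⟨ cong (ℤ._+_ s) (⊛-cong {f = one ⊖ q^ h} {g = recip D′} neg (λ _ → refl) n) ⟨
  s ℤ.+ ((one ⊖ q^ h) ⊛ recip D′) n
                     ≡⟨ cong (ℤ._+_ s) (recip-⊛ (one ⊖ q^ h) D₀ D′₀ D′≗ n) ⟨
  s ℤ.+ recip D n    ∎
  where
  open ≡-Reasoning
  r = recip D′ n
  s = shift h (recip D′) n
  lemma : ∀ r s → r ≡ s ℤ.+ (-1ℤ ℤ.* s ℤ.+ r)
  lemma = ℤ-solve-∀
  neg : one ⊖ q^ h ≗ scale-add -1ℤ (q^ h) one
  neg k = lemma′ (one k) ((q^ h) k)
    where
    lemma′ : ∀ a b → a ℤ.- b ≡ -1ℤ ℤ.* b ℤ.+ a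
    lemma′ = ℤ-solve-∀

⊘-monomial : ∀ c e D n → ((c · q^ e) ⊘ D) n ≡ c ℤ.* shift e (recip D) n
⊘-monomial c e D n = begin
  ((c · q^ e) ⊛ recip D) n ≡⟨ ⊛-cong {g = recip D} (λ k → sym (ℤₚ.+-identityʳ (c ℤ.* (q^ e) k))) (λ _ → refl) n ⟩
  (scale-add c (q^ e) (λ _ → 0ℤ) ⊛ recip D) n ≡⟨ ⊛-scale-addˡ c (q^ e) (λ _ → 0ℤ) (recip D) n ⟩
  c ℤ.* (q^ e ⊛ recip D) n ℤ.+ ((λ _ → 0ℤ) ⊛ recip D) n
    ≡⟨ cong₂ (λ a b → c ℤ.* a ℤ.+ b) (q^⊛ e (recip D) n) (zero-⊛ (recip D) n) ⟩
  c ℤ.* shift e (recip D) n ℤ.+ 0ℤ ≡⟨ ℤₚ.+-identityʳ _ ⟩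
  c ℤ.* shift e (recip D) n ∎
  where open ≡-Reasoning

-- As both arguments of `poch` are qʷ, the product `a ⊛ b ^ₛ i` in the new factor is by definition
-- the power `b ^ₛ suc i`.
poch-suc : ∀ w i → poch (q^ w) (q^ w) (suc i) ≗ poch (q^ w) (q^ w) i ⊛ (one ⊖ q^ (suc i * w))
poch-suc w i = ⊛-cong {poch (q^ w) (q^ w) i} (λ _ → refl)
  (λ n → cong (ℤ._-_ (one n)) (q^-^ₛ w (suc i) n))

-- Finite sums

module _ {A : Set} where

  ∑ : List A → (A → ℤ) → ℤ
  ∑ xs f = sumℤ (map f xs)

  ∑-cong : ∀ xs {f g : A → ℤ} → (∀ x → f x ≡ g x) → ∑ xs f ≡ ∑ xs g
  ∑-cong []       p = refl
  ∑-cong (x ∷ xs) p = cong₂ ℤ._+_ (p x) (∑-cong xs p)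

  ∑-zero : ∀ xs {f : A → ℤ} → (∀ x → f x ≡ 0ℤ) → ∑ xs f ≡ 0ℤ
  ∑-zero []       p = refl
  ∑-zero (x ∷ xs) p = cong₂ ℤ._+_ (p x) (∑-zero xs p)

  ∑-+ : ∀ xs (f g : A → ℤ) → ∑ xs (λ x → f x ℤ.+ g x) ≡ ∑ xs f ℤ.+ ∑ xs g
  ∑-+ []       f g = refl
  ∑-+ (x ∷ xs) f g =
    trans (cong (λ z → f x ℤ.+ g x ℤ.+ z) (∑-+ xs f g)) (lemma (f x) (g x) (∑ xs f) (∑ xs g))
    where
    lemma : ∀ a b c d → a ℤ.+ b ℤ.+ (c ℤ.+ d) ≡ a ℤ.+ c ℤ.+ (b ℤ.+ d)
    lemma = ℤ-solve-∀

  ∑-++ : ∀ xs ys (f : A → ℤ) → ∑ (xs ++ ys) f ≡ ∑ xs f ℤ.+ ∑ ys f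
  ∑-++ []       ys f = sym (ℤₚ.+-identityˡ _)
  ∑-++ (x ∷ xs) ys f =
    trans (cong (ℤ._+_ (f x)) (∑-++ xs ys f)) (sym (ℤₚ.+-assoc (f x) _ _))

∑-× : ∀ {A B : Set} (xs : List A) (ys : List B) f →
      ∑ (cartesianProduct xs ys) f ≡ ∑ xs (λ x → ∑ ys (λ y → f (x , y)))
∑-× []       ys f = refl
∑-× (x ∷ xs) ys f = trans (∑-++ (map (x ,_) ys) _ f)
  (cong₂ ℤ._+_ (cong sumℤ (sym (map-∘ ys))) (∑-× xs ys f))

-- The f-terms below N bring in h only up to index N - 2. The last hypothesis kills the remaining h
-- (N - 1), so that all three sums have the same range.
∑-upTo-step : ∀ N {f g h : ℕ → ℤ} → f 0 ≡ g 0 → (∀ i → f (suc i) ≡ g (suc i) ℤ.+ h i) →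
              (∀ i → suc i ≡ N → h i ≡ 0ℤ) → ∑ (upTo N) f ≡ ∑ (upTo N) g ℤ.+ ∑ (upTo N) h
∑-upTo-step N {f} {g} {h} p₀ p₊ end
  rewrite map-upTo f N | map-upTo g N | map-upTo h N = go N f g h p₀ p₊ end
  where
  go : ∀ N f g h → f 0 ≡ g 0 → (∀ i → f (suc i) ≡ g (suc i) ℤ.+ h i) →
       (∀ i → suc i ≡ N → h i ≡ 0ℤ) →
       sumℤ (applyUpTo f N) ≡ sumℤ (applyUpTo g N) ℤ.+ sumℤ (applyUpTo h N)
  go zero    f g h p₀ p₊ end = refl
  go (suc zero) f g h p₀ p₊ end rewrite p₀ | end 0 refl = sym (ℤₚ.+-identityʳ _)
  go (suc (suc N)) f g h p₀ p₊ end = begin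
    f 0 ℤ.+ sumℤ (applyUpTo (f ∘ suc) (suc N))
      ≡⟨ cong₂ ℤ._+_ p₀ (go (suc N) (f ∘ suc) g+ (h ∘ suc) (p₊ 0) (p₊ ∘ suc) (λ i e → end (suc i) (cong suc e))) ⟩
    g 0 ℤ.+ (g 1 ℤ.+ h 0 ℤ.+ sumℤ (applyUpTo (g ∘ suc ∘ suc) N) ℤ.+ sumℤ (applyUpTo (h ∘ suc) (suc N)))
      ≡⟨ lemma (g 0) (g 1) (h 0) (sumℤ (applyUpTo (g ∘ suc ∘ suc) N)) _ ⟩
    g 0 ℤ.+ (g 1 ℤ.+ sumℤ (applyUpTo (g ∘ suc ∘ suc) N)) ℤ.+ (h 0 ℤ.+ sumℤ (applyUpTo (h ∘ suc) (suc N))) ∎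
    where
    open ≡-Reasoning
    -- The term h 0 is merged into the head of the shifted g, so that the sequences `f ∘ suc` and
    -- `g+` start equal.
    g+ : ℕ → ℤ
    g+ zero    = g 1 ℤ.+ h 0
    g+ (suc i) = g (2 + i)
    lemma : ∀ a b c d e → a ℤ.+ (b ℤ.+ c ℤ.+ d ℤ.+ e) ≡ a ℤ.+ (b ℤ.+ d) ℤ.+ (c ℤ.+ e)
    lemma = ℤ-solve-∀

-- For a step in one coordinate of a nested product: `∑-stepʳ` passes over the coordinates before
-- it, and y here collects those after it.
∑-stepˡ : ∀ {A : Set} N (ys : List A) {f g h : ℕ × A → ℤ} →
          (∀ y → f (0 , y) ≡ g (0 , y)) → (∀ i y → f (suc i , y) ≡ g (suc i , y) ℤ.+ h (i , y)) →
          (∀ i y → suc i ≡ N → h (i , y) ≡ 0ℤ) →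
          let xs = cartesianProduct (upTo N) ys in ∑ xs f ≡ ∑ xs g ℤ.+ ∑ xs h
∑-stepˡ N ys {f} {g} {h} p₀ p₊ end
  rewrite ∑-× (upTo N) ys f | ∑-× (upTo N) ys g | ∑-× (upTo N) ys h =
  ∑-upTo-step N (∑-cong ys p₀) (λ i → trans (∑-cong ys (p₊ i)) (∑-+ ys _ _))
    (λ i e → ∑-zero ys (λ y → end i y e))

∑-stepʳ : ∀ {A B : Set} (xs : List A) (ys : List B) {f g h : A × B → ℤ} →
          (∀ x → ∑ ys (λ y → f (x , y)) ≡ ∑ ys (λ y → g (x , y)) ℤ.+ ∑ ys (λ y → h (x , y))) →
          let zs = cartesianProduct xs ys in ∑ zs f ≡ ∑ zs g ℤ.+ ∑ zs h
∑-stepʳ xs ys {f} {g} {h} p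
  rewrite ∑-× xs ys f | ∑-× xs ys g | ∑-× xs ys h = trans (∑-cong xs p) (∑-+ xs _ _)

-- Multiplication by monomials in x and q

shift₂ : ℕ → ℕ → ℤ⟦x,q⟧ → ℤ⟦x,q⟧
shift₂ a b F m n = shift a (λ m′ → shift b (F m′) n) m

shift₂-cong : ∀ a b {F G : ℤ⟦x,q⟧} m n → (∀ m′ n′ → a + m′ ≡ m → b + n′ ≡ n → F m′ n′ ≡ G m′ n′) →
              shift₂ a b F m n ≡ shift₂ a b G m n
shift₂-cong a b m n p = shift-cong a m (λ m′ em → shift-cong b n (λ n′ en → p m′ n′ em en))

shift₂-zero : ∀ a b {F : ℤ⟦x,q⟧} m n → (∀ m′ n′ → a + m′ ≡ m → F m′ n′ ≡ 0ℤ) → shift₂ a b F m n ≡ 0ℤ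
shift₂-zero a b m n p =
  trans (shift₂-cong a b {G = λ _ _ → 0ℤ} m n (λ m′ n′ em _ → p m′ n′ em))
    (trans (shift-cong a m (λ _ _ → shift-zero b n)) (shift-zero a m))

shift₂-+ : ∀ a b F G m n → shift₂ a b (λ m n → F m n ℤ.+ G m n) m n ≡ shift₂ a b F m n ℤ.+ shift₂ a b G m n
shift₂-+ a b F G m n =
  trans (shift-cong a m (λ m′ _ → shift-+ b (F m′) (G m′) n)) (shift-+ a _ _ m)

shift₂-∑ : ∀ {A : Set} a b (xs : List A) (F : A → ℤ⟦x,q⟧) m n →
           shift₂ a b (λ m n → ∑ xs (λ x → F x m n)) m n ≡ ∑ xs (λ x → shift₂ a b (F x) m n)
shift₂-∑ a b []       F m n = shift₂-zero a b m n (λ _ _ _ → refl)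
shift₂-∑ a b (x ∷ xs) F m n =
  trans (shift₂-+ a b (F x) _ m n) (cong (ℤ._+_ (shift₂ a b (F x) m n)) (shift₂-∑ a b xs F m n))

shift₂-shift₂ : ∀ a b c d F m n → shift₂ a b (shift₂ c d F) m n ≡ shift₂ (a + c) (b + d) F m n
shift₂-shift₂ a b c d F m n = trans
  (shift-cong a m (λ m′ _ → trans (swap c m′) (shift-cong c m′ (λ m″ _ → shift-shift b d (F m″) n))))
  (shift-shift a c _ m)
  where
  -- The outer q-shift has to pass the inner x-shift before the shifts in the same variable can
  -- merge.
  swap : ∀ c m′ → shift b (λ n → shift c (λ m″ → shift d (F m″) n) m′) n
                ≡ shift c (λ m″ → shift b (shift d (F m″)) n) m′
  swap = go F
    where
    go : ∀ F c m′ → shift b (λ n → shift c (λ m″ → shift d (F m″) n) m′) n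
                ≡ shift c (λ m″ → shift b (shift d (F m″)) n) m′
    go F zero    m′       = refl
    go F (suc c) zero     = shift-zero b n
    go F (suc c) (suc m′) = go F c m′

x^-cong : ∀ {M M′ f g} → M ≡ M′ → f ≗ g → ∀ m n → (x^ M · f) m n ≡ (x^ M′ · g) m n
x^-cong {M} refl p m n with m ≡ᵇ M
... | true  = p n
... | false = refl

x^-zero : ∀ M f m n → f n ≡ 0ℤ → (x^ M · f) m n ≡ 0ℤ
x^-zero M f m n p with m ≡ᵇ M
... | true  = p
... | false = refl

q^-≢ : ∀ {e n} → n ≢ e → (q^ e) n ≡ 0ℤ
q^-≢ {e} {n} n≢e with n ≡ᵇ e in eq
... | true  = contradiction (ℕₚ.≡ᵇ⇒≡ n e (subst Bool.T (sym eq) _)) n≢e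
... | false = refl

x^-≢ : ∀ {M} f {m} n → m ≢ M → (x^ M · f) m n ≡ 0ℤ
x^-≢ {M} f {m} n m≢M with m ≡ᵇ M in eq
... | true  = contradiction (ℕₚ.≡ᵇ⇒≡ m M (subst Bool.T (sym eq) _)) m≢M
... | false = refl

shift₂-x^ : ∀ w e M f m n → shift₂ w e (x^ M · f) m n ≡ (x^ (w + M) · shift e f) m n
shift₂-x^ zero    e M f m n with m ≡ᵇ M
... | true  = refl
... | false = shift-zero e n
shift₂-x^ (suc w) e M f zero    n = refl
shift₂-x^ (suc w) e M f (suc m) n = shift₂-x^ w e M f m n

x^-step : ∀ {M w M₀ e f g h} → M ≡ w + M₀ → (∀ n → f n ≡ g n ℤ.+ shift e h n) → ∀ m n →
          (x^ M · f) m n ≡ (x^ M · g) m n ℤ.+ shift₂ w e (x^ M₀ · h) m n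
x^-step {w = w} {M₀} {e} {f} {g} {h} refl p m n =
  trans lemma (cong (ℤ._+_ ((x^ (w + M₀) · g) m n)) (sym (shift₂-x^ w e M₀ h m n)))
  where
  lemma : (x^ (w + M₀) · f) m n ≡ (x^ (w + M₀) · g) m n ℤ.+ (x^ (w + M₀) · shift e h) m n
  lemma with m ≡ᵇ w + M₀
  ... | true  = p n
  ... | false = refl

-- The terms of the quadruple sums

Quad : Set
Quad = ℕ × ℕ × ℕ × ℕ

weight : Quad → ℕ
weight (i , j , k , l) = i + 2 * j + 3 * k + 4 * l

den : Quad → ℤ⟦q⟧
den (i , j , k , l) = poch (q^ 1) (q^ 1) i ⊛ poch (q^ 2) (q^ 2) j
                    ⊛ poch (q^ 3) (q^ 3) k ⊛ poch (q^ 4) (q^ 4) l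

tri : ℕ → ℕ
tri M = M * (M ∸ 1) / 2

-- The first argument holds the coefficients of i, j, k and l in the linear part. They are kept
-- variable because the recurrences move them.
expo : Quad → Quad → ℕ
expo (α , β , γ , δ) x@(i , j , k , l) = tri (weight x) + 2 * l ^ 2 + α * i + β * j + γ * k + δ * l

sign : Quad → ℤ
sign (_ , _ , _ , l) = -1ℤ ^ℤ l

term : Quad → Quad → ℤ⟦x,q⟧
term p x = x^ weight x · (sign x · q^ expo p x ⊘ den x)

den-const : ∀ x → den x 0 ≡ 1ℤ
den-const (i , j , k , l) = ⊛-const (P₁ ⊛ P₂ ⊛ P₃) P₄ (⊛-const (P₁ ⊛ P₂) P₃ (⊛-const P₁ P₂
  (poch-const 0 (q^ 1) i) (poch-const 1 (q^ 2) j)) (poch-const 2 (q^ 3) k)) (poch-const 3 (q^ 4) l)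
  where
  P₁ = poch (q^ 1) (q^ 1) i
  P₂ = poch (q^ 2) (q^ 2) j
  P₃ = poch (q^ 3) (q^ 3) k
  P₄ = poch (q^ 4) (q^ 4) l

⊛-pullʳ : ∀ f f′ g u → f′ ≗ f ⊛ u → f′ ⊛ g ≗ f ⊛ g ⊛ u
⊛-pullʳ f f′ g u p n = trans (⊛-cong {g = g} p (λ _ → refl) n) (xy∙z≈xz∙y f u g n)

⊛-pullˡ : ∀ f g g′ u → g′ ≗ g ⊛ u → f ⊛ g′ ≗ f ⊛ g ⊛ u
⊛-pullˡ f g g′ u p n = trans (⊛-cong {f} (λ _ → refl) p n) (sym (⊛-assoc f g u n))

module _ (i j k l : ℕ) where
  private
    P₁ = poch (q^ 1) (q^ 1)
    P₂ = poch (q^ 2) (q^ 2)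
    P₃ = poch (q^ 3) (q^ 3)
    P₄ = poch (q^ 4) (q^ 4)

  den-suc₁ : den (suc i , j , k , l) ≗ den (i , j , k , l) ⊛ (one ⊖ q^ (suc i * 1))
  den-suc₁ = ⊛-pullʳ (P₁ i ⊛ P₂ j ⊛ P₃ k) (P₁ (suc i) ⊛ P₂ j ⊛ P₃ k) (P₄ l) u
    (⊛-pullʳ (P₁ i ⊛ P₂ j) (P₁ (suc i) ⊛ P₂ j) (P₃ k) u
      (⊛-pullʳ (P₁ i) (P₁ (suc i)) (P₂ j) u (poch-suc 1 i)))
    where u = one ⊖ q^ (suc i * 1)

  den-suc₂ : den (i , suc j , k , l) ≗ den (i , j , k , l) ⊛ (one ⊖ q^ (suc j * 2))
  den-suc₂ = ⊛-pullʳ (P₁ i ⊛ P₂ j ⊛ P₃ k) (P₁ i ⊛ P₂ (suc j) ⊛ P₃ k) (P₄ l) u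
    (⊛-pullʳ (P₁ i ⊛ P₂ j) (P₁ i ⊛ P₂ (suc j)) (P₃ k) u
      (⊛-pullˡ (P₁ i) (P₂ j) (P₂ (suc j)) u (poch-suc 2 j)))
    where u = one ⊖ q^ (suc j * 2)

  den-suc₃ : den (i , j , suc k , l) ≗ den (i , j , k , l) ⊛ (one ⊖ q^ (suc k * 3))
  den-suc₃ = ⊛-pullʳ (P₁ i ⊛ P₂ j ⊛ P₃ k) (P₁ i ⊛ P₂ j ⊛ P₃ (suc k)) (P₄ l) u
    (⊛-pullˡ (P₁ i ⊛ P₂ j) (P₃ k) (P₃ (suc k)) u (poch-suc 3 k))
    where u = one ⊖ q^ (suc k * 3)

  den-suc₄ : den (i , j , k , suc l) ≗ den (i , j , k , l) ⊛ (one ⊖ q^ (suc l * 4))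
  den-suc₄ = ⊛-pullˡ (P₁ i ⊛ P₂ j ⊛ P₃ k) (P₄ l) (P₄ (suc l)) (one ⊖ q^ (suc l * 4)) (poch-suc 4 l)

-- Pairs among w + M things lie in one group, in the other, or across. For M a weight, the cross
-- term w M is linear in the indices and goes into the parameters.
tri-+ : ∀ w M → tri (w + M) ≡ tri w + w * M + tri M
tri-+ zero    M = refl
tri-+ (suc w) M = begin
  tri (suc w + M)                         ≡⟨ tri-suc (w + M) ⟩
  w + M + tri (w + M)                     ≡⟨ cong (w + M +_) (tri-+ w M) ⟩
  w + M + (tri w + w * M + tri M)         ≡⟨ lemma w M (tri w) (w * M) (tri M) ⟩
  w + tri w + (M + w * M) + tri M         ≡⟨ cong (λ t → t + (M + w * M) + tri M) (tri-suc w) ⟨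
  tri (suc w) + suc w * M + tri M         ∎
  where
  open ≡-Reasoning
  lemma : ∀ w M t wM s → w + M + (t + wM + s) ≡ w + t + (M + wM) + s
  lemma = solve-∀
  tri-suc : ∀ M → tri (suc M) ≡ M + tri M
  tri-suc zero    = refl
  tri-suc (suc M) = begin
    (2 + M) * suc M / 2               ≡⟨ cong (_/ 2) (lemma′ M) ⟩
    (suc M * 2 + suc M * M) / 2       ≡⟨ +-distrib-/-∣ˡ (suc M * M) (divides-refl (suc M)) ⟩
    suc M * 2 / 2 + suc M * M / 2     ≡⟨ cong (_+ suc M * M / 2) (m*n/n≡m (suc M) 2) ⟩
    suc M + suc M * M / 2             ∎
    where
    lemma′ : ∀ M → (2 + M) * suc M ≡ suc M * 2 + suc M * M
    lemma′ = solve-∀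

-- Truncated quadruple sums and their recurrences

quads : ℕ → List Quad
quads N = cartesianProduct (upTo N) (cartesianProduct (upTo N) (cartesianProduct (upTo N) (upTo N)))

-- The coefficients of xᵐ for m < N are those of the whole quadruple sum.
Φ : ℕ → Quad → ℤ⟦x,q⟧
Φ N p m n = ∑ (quads N) (λ x → term p x m n)

-- Hence an index that reaches N forces a power of x of at least N, outside the coefficients with m
-- < N.
≤-weight : ∀ i j k l → i ≤ weight (i , j , k , l) × j ≤ weight (i , j , k , l)
                     × k ≤ weight (i , j , k , l) × l ≤ weight (i , j , k , l)
≤-weight i j k l =
    ≤-trans (≤-trans (m≤m+n i (2 * j)) (m≤m+n _ (3 * k))) (m≤m+n _ (4 * l))
  , ≤-trans (≤-trans (≤-trans (m≤n*m j 2) (m≤n+m (2 * j) i)) (m≤m+n _ (3 * k))) (m≤m+n _ (4 * l))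
  , ≤-trans (≤-trans (m≤n*m k 3) (m≤n+m (3 * k) (i + 2 * j))) (m≤m+n _ (4 * l))
  , ≤-trans (m≤n*m l 4) (m≤n+m (4 * l) (i + 2 * j + 3 * k))
  where open ℕₚ

-- This is `recip-step` times c qᴱ. In the first term a raised parameter absorbs qʰ; in the second,
-- E splits into the shift e and the exponent E₁ of the lowered index.
quotient-step : ∀ D D′ c h E E′ e E₁ → D 0 ≡ 1ℤ → D′ 0 ≡ 1ℤ → D′ ≗ D ⊛ (one ⊖ q^ h) →
                E′ ≡ E + h → E ≡ e + E₁ →
                ((c · q^ E) ⊘ D′) ≗ (λ n → ((c · q^ E′) ⊘ D′) n ℤ.+ shift e ((c · q^ E₁) ⊘ D) n)
quotient-step D D′ c h E E′ e E₁ D₀ D′₀ D′≗ refl refl n = begin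
  ((c · q^ E) ⊘ D′) n ≡⟨ ⊘-monomial c E D′ n ⟩
  c ℤ.* shift E (recip D′) n
    ≡⟨ cong (ℤ._*_ c) (trans (shift-cong E n (λ k _ → recip-step h D₀ D′₀ D′≗ k)) (shift-+ E _ _ n)) ⟩
  c ℤ.* (shift E (shift h (recip D′)) n ℤ.+ shift E (recip D) n) ≡⟨ ℤₚ.*-distribˡ-+ c _ _ ⟩
  c ℤ.* shift E (shift h (recip D′)) n ℤ.+ c ℤ.* shift E (recip D) n
    ≡⟨ cong₂ ℤ._+_ (cong (ℤ._*_ c) (shift-shift E h (recip D′) n))
                   (cong (ℤ._*_ c) (sym (shift-shift e E₁ (recip D) n))) ⟩
  c ℤ.* shift (E + h) (recip D′) n ℤ.+ c ℤ.* shift e (shift E₁ (recip D)) n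
    ≡⟨ cong₂ ℤ._+_ (⊘-monomial c (E + h) D′ n)
         (trans (shift-cong e n (λ k _ → ⊘-monomial c E₁ D k)) (shift-· e c _ n)) ⟨
  ((c · q^ (E + h)) ⊘ D′) n ℤ.+ shift e ((c · q^ E₁) ⊘ D) n ∎
  where
  open ≡-Reasoning

-- When the sign alternates with the index, the last term of `quotient-step` is -Z. Moving it to the
-- other side exchanges E and E′.
quotient-step⁻ : ∀ D D′ c h E E′ e E₁ → D 0 ≡ 1ℤ → D′ 0 ≡ 1ℤ → D′ ≗ D ⊛ (one ⊖ q^ h) →
                 E′ ≡ E + h → E ≡ e + E₁ →
                 (((-1ℤ ℤ.* c) · q^ E′) ⊘ D′)
                   ≗ (λ n → (((-1ℤ ℤ.* c) · q^ E) ⊘ D′) n ℤ.+ shift e ((c · q^ E₁) ⊘ D) n)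
quotient-step⁻ D D′ c h E E′ e E₁ D₀ D′₀ D′≗ pE′ pE n = begin
  X                     ≡⟨ lemma X Z ⟩
  X ℤ.+ -1ℤ ℤ.* Z ℤ.+ Z ≡⟨ cong (λ z → X ℤ.+ z ℤ.+ Z) neg ⟨
  X ℤ.+ shift e (((-1ℤ ℤ.* c) · q^ E₁) ⊘ D) n ℤ.+ Z
                        ≡⟨ cong (λ y → y ℤ.+ Z) (quotient-step D D′ (-1ℤ ℤ.* c) h E E′ e E₁ D₀ D′₀ D′≗ pE′ pE n) ⟨
  (((-1ℤ ℤ.* c) · q^ E) ⊘ D′) n ℤ.+ Z ∎
  where
  open ≡-Reasoning
  X = (((-1ℤ ℤ.* c) · q^ E′) ⊘ D′) n
  Z = shift e ((c · q^ E₁) ⊘ D) n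
  lemma : ∀ x z → x ≡ x ℤ.+ -1ℤ ℤ.* z ℤ.+ z
  lemma = ℤ-solve-∀
  neg : shift e (((-1ℤ ℤ.* c) · q^ E₁) ⊘ D) n ≡ -1ℤ ℤ.* Z
  neg = trans (shift-cong e n (λ k _ → trans (⊘-monomial (-1ℤ ℤ.* c) E₁ D k)
                (trans (ℤₚ.*-assoc -1ℤ c _) (cong (ℤ._*_ -1ℤ) (sym (⊘-monomial c E₁ D k))))))
              (shift-· e -1ℤ ((c · q^ E₁) ⊘ D) n)

module _ (p p′ p″ x x₀ : Quad) (w e : ℕ) {h : ℕ} (weight-x : weight x ≡ w + weight x₀)
         (den-x : den x ≗ den x₀ ⊛ (one ⊖ q^ h)) where

  -- In its uses x is x₀ with one index raised by one, and w is the coefficient of that index in the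
  -- weight. In p′ the parameter of that index has gone up; p″ absorbs the cross term of `tri-+`.
  term-step : sign x ≡ sign x₀ → expo p′ x ≡ expo p x + h → expo p x ≡ e + expo p″ x₀ →
              ∀ m n → term p x m n ≡ term p′ x m n ℤ.+ shift₂ w e (term p″ x₀) m n
  term-step sx ep′ ep rewrite sx = x^-step {w = w} {weight x₀} {e} weight-x
    (quotient-step (den x₀) (den x) (sign x₀) h (expo p x) (expo p′ x) e (expo p″ x₀)
      (den-const x₀) (den-const x) den-x ep′ ep)

  term-step⁻ : sign x ≡ -1ℤ ℤ.* sign x₀ → expo p x ≡ expo p′ x + h → expo p′ x ≡ e + expo p″ x₀ →
               ∀ m n → term p x m n ≡ term p′ x m n ℤ.+ shift₂ w e (term p″ x₀) m n
  term-step⁻ sx ep ep′ rewrite sx = x^-step {w = w} {weight x₀} {e} weight-x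
    (quotient-step⁻ (den x₀) (den x) (sign x₀) h (expo p′ x) (expo p x) e (expo p″ x₀)
      (den-const x₀) (den-const x) den-x ep ep′)

term-expo : ∀ p p′ x → expo p x ≡ expo p′ x → ∀ m n → term p x m n ≡ term p′ x m n
term-expo p p′ x eq m n rewrite eq = refl

module _ (α β γ δ : ℕ) where

  private
    tri-weight : ∀ {M} w M₀ → M ≡ w + M₀ → ∀ {a b} → a ≡ tri w + w * M₀ + tri M₀ + b → tri M + b ≡ a
    tri-weight w M₀ refl {b = b} p = trans (cong (_+ b) (tri-+ w M₀)) (sym p)

    assoc₄ : ∀ t L a b c d → t + L + a + b + c + d ≡ t + (L + a + b + c + d)
    assoc₄ = solve-∀

  module _ (i j k l : ℕ) where

    private
      x  = i , j , k , l
      M₀ = weight x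

    weight-suc₂ : weight (i , suc j , k , l) ≡ 2 + M₀
    weight-suc₂ = lemma i j k l
      where
      lemma : ∀ i j k l → i + 2 * suc j + 3 * k + 4 * l ≡ 2 + (i + 2 * j + 3 * k + 4 * l)
      lemma = solve-∀

    weight-suc₃ : weight (i , j , suc k , l) ≡ 3 + M₀
    weight-suc₃ = lemma i j k l
      where
      lemma : ∀ i j k l → i + 2 * j + 3 * suc k + 4 * l ≡ 3 + (i + 2 * j + 3 * k + 4 * l)
      lemma = solve-∀

    weight-suc₄ : weight (i , j , k , suc l) ≡ 4 + M₀
    weight-suc₄ = lemma i j k l
      where
      lemma : ∀ i j k l → i + 2 * j + 3 * k + 4 * suc l ≡ 4 + (i + 2 * j + 3 * k + 4 * l)
      lemma = solve-∀

    -- Raising an index of coefficient w adds w to M. By `tri-+` this contributes the constant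
    -- `tri w` and adds w, 2w, 3w, 4w to the parameters; here w = 1.
    expo-suc₁ : expo (α , β , γ , δ) (suc i , j , k , l) ≡ α + expo (1 + α , 2 + β , 3 + γ , 4 + δ) x
    expo-suc₁ = trans (assoc₄ (tri (weight (suc i , j , k , l))) (2 * l ^ 2) (α * suc i) (β * j) (γ * k) (δ * l))
      (tri-weight 1 M₀ refl (lemma α β γ δ i j k l (tri M₀) (2 * l ^ 2)))
      where
      lemma : ∀ α β γ δ i j k l t L →
        α + (t + L + (1 + α) * i + (2 + β) * j + (3 + γ) * k + (4 + δ) * l)
          ≡ 0 + 1 * (i + 2 * j + 3 * k + 4 * l) + t + (L + α * suc i + β * j + γ * k + δ * l)
      lemma = solve-∀

    expo-suc₂ : expo (α , β , γ , δ) (i , suc j , k , l) ≡ 1 + β + expo (2 + α , 4 + β , 6 + γ , 8 + δ) x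
    expo-suc₂ = trans (assoc₄ (tri (weight (i , suc j , k , l))) (2 * l ^ 2) (α * i) (β * suc j) (γ * k) (δ * l))
      (tri-weight 2 M₀ weight-suc₂ (lemma α β γ δ i j k l (tri M₀) (2 * l ^ 2)))
      where
      lemma : ∀ α β γ δ i j k l t L →
        1 + β + (t + L + (2 + α) * i + (4 + β) * j + (6 + γ) * k + (8 + δ) * l)
          ≡ 1 + 2 * (i + 2 * j + 3 * k + 4 * l) + t + (L + α * i + β * suc j + γ * k + δ * l)
      lemma = solve-∀

    expo-suc₃ : expo (α , β , γ , δ) (i , j , suc k , l) ≡ 3 + γ + expo (3 + α , 6 + β , 9 + γ , 12 + δ) x
    expo-suc₃ = trans (assoc₄ (tri (weight (i , j , suc k , l))) (2 * l ^ 2) (α * i) (β * j) (γ * suc k) (δ * l))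
      (tri-weight 3 M₀ weight-suc₃ (lemma α β γ δ i j k l (tri M₀) (2 * l ^ 2)))
      where
      lemma : ∀ α β γ δ i j k l t L →
        3 + γ + (t + L + (3 + α) * i + (6 + β) * j + (9 + γ) * k + (12 + δ) * l)
          ≡ 3 + 3 * (i + 2 * j + 3 * k + 4 * l) + t + (L + α * i + β * j + γ * suc k + δ * l)
      lemma = solve-∀

    -- Besides `tri 4` = 6 and the cross term, 2(l + 1)² - 2l² = 4l + 2 contributes: hence 8 = 6 + 2
    -- and 20 = 16 + 4.
    expo-suc₄ : expo (α , β , γ , δ) (i , j , k , suc l) ≡ 8 + δ + expo (4 + α , 8 + β , 12 + γ , 20 + δ) x
    expo-suc₄ = trans (assoc₄ (tri (weight (i , j , k , suc l))) (2 * suc l ^ 2) (α * i) (β * j) (γ * k) (δ * suc l))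
      (tri-weight 4 M₀ weight-suc₄ (lemma α β γ δ i j k l (tri M₀)))
      where
      lemma : ∀ α β γ δ i j k l t →
        8 + δ + (t + 2 * (l * (l * 1)) + (4 + α) * i + (8 + β) * j + (12 + γ) * k + (20 + δ) * l)
          ≡ 6 + 4 * (i + 2 * j + 3 * k + 4 * l) + t
            + (2 * (suc l * (suc l * 1)) + α * i + β * j + γ * k + δ * suc l)
      lemma = solve-∀

  -- The increase is the exponent of the last factor of the Pochhammer symbol for i, as
  -- `quotient-step` wants of h; likewise for the other three.
  expo-α : ∀ (x@(i , _) : Quad) → expo (1 + α , β , γ , δ) x ≡ expo (α , β , γ , δ) x + i * 1
  expo-α (i , j , k , l) = lemma α i (tri (weight (i , j , k , l)) + 2 * l ^ 2) (β * j) (γ * k) (δ * l)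
    where
    lemma : ∀ α i a b c d → a + (1 + α) * i + b + c + d ≡ a + α * i + b + c + d + i * 1
    lemma = solve-∀

  expo-β : ∀ (x@(_ , j , _) : Quad) → expo (α , 2 + β , γ , δ) x ≡ expo (α , β , γ , δ) x + j * 2
  expo-β (i , j , k , l) = lemma β j (tri (weight (i , j , k , l)) + 2 * l ^ 2 + α * i) (γ * k) (δ * l)
    where
    lemma : ∀ β j a c d → a + (2 + β) * j + c + d ≡ a + β * j + c + d + j * 2
    lemma = solve-∀

  expo-γ : ∀ (x@(_ , _ , k , _) : Quad) → expo (α , β , 3 + γ , δ) x ≡ expo (α , β , γ , δ) x + k * 3
  expo-γ (i , j , k , l) = lemma γ k (tri (weight (i , j , k , l)) + 2 * l ^ 2 + α * i + β * j) (δ * l)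
    where
    lemma : ∀ γ k a d → a + (3 + γ) * k + d ≡ a + γ * k + d + k * 3
    lemma = solve-∀

  expo-δ : ∀ (x@(_ , _ , _ , l) : Quad) → expo (α , β , γ , 4 + δ) x ≡ expo (α , β , γ , δ) x + l * 4
  expo-δ (i , j , k , l) = lemma δ l (tri (weight (i , j , k , l)) + 2 * l ^ 2 + α * i + β * j + γ * k)
    where
    lemma : ∀ δ l a → a + (4 + δ) * l ≡ a + δ * l + l * 4
    lemma = solve-∀

  module _ {N m : ℕ} (m<N : m < N) (n : ℕ) where

    private
      p = α , β , γ , δ

      -- The boundary condition of `∑-upTo-step`: an index N - 1 makes the weight at least N - 1,
      -- and the shift adds at least one more x, so xᵐ with m < N is not reached.
      vanish : ∀ {c} w e p x → c ≤ weight x → suc c ≡ N → shift₂ (suc w) e (term p x) m n ≡ 0ℤ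
      vanish w e p x c≤M refl = shift₂-zero (suc w) e {term p x} m n λ m′ n′ w+m′≡m →
        x^-≢ (sign x · q^ expo p x ⊘ den x) n′ λ m′≡M → ℕₚ.<-irrefl refl (begin-strict
          m               <⟨ m<N ⟩
          suc _           ≤⟨ s≤s c≤M ⟩
          suc (weight x)  ≡⟨ cong suc m′≡M ⟨
          suc m′          ≤⟨ s≤s (ℕₚ.m≤n+m m′ w) ⟩
          suc w + m′      ≡⟨ w+m′≡m ⟩
          m               ∎)
        where open ℕₚ.≤-Reasoning

      Q₂ = cartesianProduct (upTo N) (upTo N)
      Q₃ = cartesianProduct (upTo N) Q₂

      from-terms : ∀ p p′ p″ w e →
        ∑ (quads N) (λ x → term p x m n)
          ≡ ∑ (quads N) (λ x → term p′ x m n) ℤ.+ ∑ (quads N) (λ x → shift₂ w e (term p″ x) m n) →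
        Φ N p m n ≡ Φ N p′ m n ℤ.+ shift₂ w e (Φ N p″) m n
      from-terms p p′ p″ w e eq =
        trans eq (cong (ℤ._+_ (Φ N p′ m n)) (sym (shift₂-∑ w e (quads N) (term p″) m n)))

    -- Terms with i = 0 do not see α; the others split by `term-step`. Combinatorially, a single
    -- part put in front adds 1 to each of the M later parts, whence the increments 1, 2, 3, 4 in
    -- p″.
    Φ-α : let p′ = 1 + α , β , γ , δ
              p″ = 1 + α , 2 + β , 3 + γ , 4 + δ
          in Φ N p m n ≡ Φ N p′ m n ℤ.+ shift₂ 1 α (Φ N p″) m n
    Φ-α = from-terms p p′ p″ 1 α (∑-stepˡ N Q₃
      (λ y → term-expo p p′ (0 , y) (sym (trans (expo-α (0 , y)) (ℕₚ.+-identityʳ _))) m n)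
      (λ { i y@(j , k , l) → term-step p p′ p″ (suc i , y) (i , y) 1 α refl (den-suc₁ i j k l)
        refl (expo-α (suc i , y)) (expo-suc₁ i j k l) m n })
      (λ { i y@(j , k , l) → let i≤ , _ = ≤-weight i j k l in vanish 0 α p″ (i , y) i≤ }))
      where
      p′ = 1 + α , β , γ , δ
      p″ = 1 + α , 2 + β , 3 + γ , 4 + δ

    Φ-β : let p′ = α , 2 + β , γ , δ
              p″ = 2 + α , 4 + β , 6 + γ , 8 + δ
          in Φ N p m n ≡ Φ N p′ m n ℤ.+ shift₂ 2 (1 + β) (Φ N p″) m n
    Φ-β = from-terms p p′ p″ 2 (1 + β) (∑-stepʳ (upTo N) Q₃ λ i → ∑-stepˡ N Q₂
      (λ y → term-expo p p′ (i , 0 , y) (sym (trans (expo-β (i , 0 , y)) (ℕₚ.+-identityʳ _))) m n)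
      (λ { j y@(k , l) → term-step p p′ p″ (i , suc j , y) (i , j , y) 2 (1 + β)
        (weight-suc₂ i j k l) (den-suc₂ i j k l)
        refl (expo-β (i , suc j , y)) (expo-suc₂ i j k l) m n })
      (λ { j y@(k , l) → let _ , j≤ , _ = ≤-weight i j k l in vanish 1 (1 + β) p″ (i , j , y) j≤ }))
      where
      p′ = α , 2 + β , γ , δ
      p″ = 2 + α , 4 + β , 6 + γ , 8 + δ

    Φ-γ : let p′ = α , β , 3 + γ , δ
              p″ = 3 + α , 6 + β , 9 + γ , 12 + δ
          in Φ N p m n ≡ Φ N p′ m n ℤ.+ shift₂ 3 (3 + γ) (Φ N p″) m n
    Φ-γ = from-terms p p′ p″ 3 (3 + γ) (∑-stepʳ (upTo N) Q₃ λ i → ∑-stepʳ (upTo N) Q₂ λ j →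
      ∑-stepˡ N (upTo N)
      (λ l → term-expo p p′ (i , j , 0 , l) (sym (trans (expo-γ (i , j , 0 , l)) (ℕₚ.+-identityʳ _))) m n)
      (λ k l → term-step p p′ p″ (i , j , suc k , l) (i , j , k , l) 3 (3 + γ)
        (weight-suc₃ i j k l) (den-suc₃ i j k l)
        refl (expo-γ (i , j , suc k , l)) (expo-suc₃ i j k l) m n)
      (λ k l → let _ , _ , k≤ , _ = ≤-weight i j k l in vanish 2 (3 + γ) p″ (i , j , k , l) k≤))
      where
      p′ = α , β , 3 + γ , δ
      p″ = 3 + α , 6 + β , 9 + γ , 12 + δ

    -- The alternating sign makes this recurrence run backwards: the sum with the raised parameter
    -- is the one that decomposes.
    Φ-δ : let p′ = α , β , γ , 4 + δ
              p″ = 4 + α , 8 + β , 12 + γ , 20 + δ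
          in Φ N p′ m n ≡ Φ N p m n ℤ.+ shift₂ 4 (8 + δ) (Φ N p″) m n
    Φ-δ = from-terms p′ p p″ 4 (8 + δ) (∑-stepʳ (upTo N) Q₃ λ i → ∑-stepʳ (upTo N) Q₂ λ j →
      ∑-stepʳ (upTo N) (upTo N) λ k → ∑-upTo-step N
      (term-expo p′ p (i , j , k , 0) (trans (expo-δ (i , j , k , 0)) (ℕₚ.+-identityʳ _)) m n)
      (λ l → term-step⁻ p′ p p″ (i , j , k , suc l) (i , j , k , l) 4 (8 + δ)
        (weight-suc₄ i j k l) (den-suc₄ i j k l)
        refl (expo-δ (i , j , k , suc l)) (expo-suc₄ i j k l) m n)
      (λ l → let _ , _ , _ , l≤ = ≤-weight i j k l in vanish 3 (8 + δ) p″ (i , j , k , l) l≤))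
      where
      p′ = α , β , γ , 4 + δ
      p″ = 4 + α , 8 + β , 12 + γ , 20 + δ

-- Partitions as words of runs

infix 4 _≼_

_≼_ : List ℕ → List ℕ → Set
_≼_ = Prefix _≡_

-- A state lists the runs that may come next: those from S, D or T on or, in the
-- state T∖S, from T on except the next S. Parts are not shifted: the level v is
-- the subscript of the first run that could come next plus the number of parts
-- already read. The fuel f bounds how far v may rise.
data State : Set where
  S D T T∖S : State

mutual
  genS genD genT genT∖S : ℕ → ℕ → List (List ℕ)

  genS zero    v = [] ∷ []
  genS (suc f) v = genD (suc f) v ++ map (replicate 1 v ++_) (genS f (1 + v))

  genD zero    v = [] ∷ []
  genD (suc f) v = genT (suc f) v ++ map (replicate 2 (1 + v) ++_) (genD f (2 + v))

  genT zero    v = [] ∷ []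
  genT (suc f) v = genS f (1 + v) ++ map (replicate 3 (2 + v) ++_) (genT∖S f (3 + v))

  genT∖S zero    v = [] ∷ []
  genT∖S (suc f) v = genD f (1 + v) ++ map (replicate 3 (2 + v) ++_) (genT∖S f (3 + v))

gen : State → ℕ → ℕ → List (List ℕ)
gen S   = genS
gen D   = genD
gen T   = genT
gen T∖S = genT∖S

gen-zero : ∀ X v → gen X 0 v ≡ [] ∷ []
gen-zero S   v = refl
gen-zero D   v = refl
gen-zero T   v = refl
gen-zero T∖S v = refl

-- Follows the calls of the `gen` functions: at fuel `suc f`, T and T∖S look only at fuel f, then D
-- looks at T, and S at D, with the same fuel.
state-induction : (P : State → ℕ → Set) → (∀ X → P X 0) →
  (∀ f → P D (suc f) → P S f → P S (suc f)) →
  (∀ f → P T (suc f) → P D f → P D (suc f)) →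
  (∀ f → P S f → P T∖S f → P T (suc f)) →
  (∀ f → P D f → P T∖S f → P T∖S (suc f)) →
  ∀ X f → P X f
state-induction P P0 PS PD PT PT∖S X f = select X (all f)
  where
  All-states : ℕ → Set
  All-states f = P S f × P D f × P T f × P T∖S f
  all : ∀ f → All-states f
  all zero    = P0 S , P0 D , P0 T , P0 T∖S
  all (suc f) with all f
  ... | s , d , t , t∖s =
    let t⁺ = PT f s t∖s
        d⁺ = PD f t⁺ d
    in PS f d⁺ s , d⁺ , t⁺ , PT∖S f d t∖s
  select : ∀ X → All-states f → P X f
  select S   (s , _ , _ , _)   = s
  select D   (_ , d , _ , _)   = d
  select T   (_ , _ , t , _)   = t
  select T∖S (_ , _ , _ , t∖s) = t∖s

-- What may not come first: in S, the pair v v would be the run D below Sᵥ and three parts v + 1 the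
-- run T below it; in T, two parts v + 1 would be Dᵥ; in T∖S, nothing may begin with v + 1, which
-- also excludes Sᵥ₊₁.
Allowed : State → ℕ → List ℕ → Set
Allowed S   v π = All (v ≤_) π × ¬ replicate 2 v ≼ π × ¬ replicate 3 (1 + v) ≼ π
Allowed D   v π = All (1 + v ≤_) π × ¬ replicate 3 (1 + v) ≼ π
Allowed T   v π = All (1 + v ≤_) π × ¬ replicate 2 (1 + v) ≼ π
Allowed T∖S v π = All (2 + v ≤_) π

Admissible : State → ℕ → List ℕ → Set
Admissible X v π = 𝒞 π × Allowed X v π

𝒞-tail : ∀ {x π} → 𝒞 (x ∷ π) → 𝒞 π
𝒞-tail ((_ ∷ pos , inc) , avoid) = (pos , Linked.tail inc) , λ i 1≤i →
  let a , b , c , d , e = avoid i 1≤i in a ∘ there , b ∘ there , c ∘ there , d ∘ there , e ∘ there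

𝒞-all : ∀ {x π} → 𝒞 (x ∷ π) → All (x ≤_) π
𝒞-all ((_ , inc) , _) with Linked⇒All ℕₚ.≤-trans ℕₚ.≤-refl inc
... | _ ∷ all = all

-- The five patterns for i = x with their first part removed: if π avoids the patterns, an
-- occurrence in `x ∷ π` must begin at x.
Compatible : ℕ → List ℕ → Set
Compatible x π = ¬ (1 + x ∷ 1 + x ∷ [] ≼ π) × ¬ (x ∷ 1 + x ∷ [] ≼ π)
               × ¬ (replicate 3 (2 + x) ≼ π) × ¬ (x ∷ x ∷ 2 + x ∷ [] ≼ π)
               × ¬ (replicate 3 x ≼ π)

𝒞-head : ∀ {x π} → 𝒞 (x ∷ π) → Compatible x π
𝒞-head {x} ((1≤x ∷ _ , _) , avoid) = let a , b , c , d , e = avoid x 1≤x in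
    (λ p → a (here (refl ∷ p))) , (λ p → b (here (refl ∷ p))) , (λ p → c (here (refl ∷ p)))
  , (λ p → d (here (refl ∷ p))) , (λ p → e (here (refl ∷ p)))

𝒞-cons : ∀ {x π} → 1 ≤ x → All (x ≤_) π → 𝒞 π → Compatible x π → 𝒞 (x ∷ π)
𝒞-cons {x} 1≤x x≤ ((pos , inc) , avoid) (a , b , c , d , e) = (1≤x ∷ pos , linked x≤ inc) , λ i 1≤i →
  let a′ , b′ , c′ , d′ , e′ = avoid i 1≤i in
    (λ { (here (refl ∷ p)) → a p ; (there q) → a′ q })
  , (λ { (here (refl ∷ p)) → b p ; (there q) → b′ q })
  , (λ { (here (refl ∷ p)) → c p ; (there q) → c′ q })
  , (λ { (here (refl ∷ p)) → d p ; (there q) → d′ q })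
  , (λ { (here (refl ∷ p)) → e p ; (there q) → e′ q })
  where
  linked : ∀ {π} → All (x ≤_) π → Linked _≤_ π → Linked _≤_ (x ∷ π)
  linked []        []  = [-]
  linked (x≤y ∷ _) inc = x≤y ∷ inc

≼-≥ : ∀ {b y ys π} → All (b ≤_) π → y < b → ¬ (y ∷ ys ≼ π)
≼-≥ (b≤y ∷ _) y<b (refl ∷ _) = ℕₚ.<⇒≱ y<b b≤y

weaken : ∀ {a b π} → a ≤ b → All (b ≤_) π → All (a ≤_) π
weaken a≤b = All.map (ℕₚ.≤-trans a≤b)

-- As the parts increase weakly, only the first one has to be compared with v.
raise : ∀ {v π} → 𝒞 π → All (v ≤_) π → ¬ (v ∷ [] ≼ π) → All (suc v ≤_) π
raise _ [] _ = []
raise 𝒞π (v≤x ∷ _) v⋠ =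
  let v<x = ℕₚ.≤∧≢⇒< v≤x (λ v≡x → v⋠ (v≡x ∷ [])) in v<x ∷ weaken v<x (𝒞-all 𝒞π)

-- Three conditions of `Compatible` hold because all later parts exceed v; the other two are the
-- prefix conditions of `Allowed S (1 + v)`.
extend-S : ∀ {v π} → 1 ≤ v → Admissible S (1 + v) π → Admissible S v (v ∷ π)
extend-S {v} 1≤v (𝒞π , v< , v²⋠ , v³⋠) =
    𝒞-cons 1≤v v≤ 𝒞π (v²⋠ , v⋠ , v³⋠ , v⋠ , v⋠)
  , ℕₚ.≤-refl ∷ v≤ , (λ { (_ ∷ p) → v⋠ p }) , λ { (() ∷ _) }
  where
  v≤ = weaken (ℕₚ.n≤1+n v) v<
  v⋠ : ∀ {ys} → ¬ (v ∷ ys ≼ _)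
  v⋠ = ≼-≥ v< ℕₚ.≤-refl

extend-D : ∀ {v π} → Admissible D (2 + v) π → Admissible D v (1 + v ∷ 1 + v ∷ π)
extend-D {v} (𝒞π , u+2≤ , v³⋠) =
    𝒞-cons (s≤s z≤n) (ℕₚ.≤-refl ∷ u≤)
      (𝒞-cons (s≤s z≤n) u≤ 𝒞π (u+1⋠ , u⋠ , v³⋠ , u⋠ , u⋠))
      ((λ { (() ∷ _) }) , (λ { (_ ∷ p) → u+1⋠ p }) , (λ { (() ∷ _) })
        , (λ { (_ ∷ p) → u⋠ p }) , (λ { (_ ∷ p) → u⋠ p }))
  , ℕₚ.≤-refl ∷ ℕₚ.≤-refl ∷ u≤ , λ { (_ ∷ _ ∷ p) → u⋠ p }
  where
  u≤ = weaken (ℕₚ.m≤n+m (1 + v) 2) u+2≤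
  u⋠ : ∀ {ys} → ¬ (1 + v ∷ ys ≼ _)
  u⋠ = ≼-≥ u+2≤ (ℕₚ.n≤1+n _)
  u+1⋠ : ∀ {ys} → ¬ (2 + v ∷ ys ≼ _)
  u+1⋠ = ≼-≥ u+2≤ ℕₚ.≤-refl

extend-T∖S : ∀ {v π} → Admissible T∖S (3 + v) π → Admissible T∖S v (replicate 3 (2 + v) ++ π)
extend-T∖S {v} (𝒞π , u+3≤) =
    𝒞-cons (s≤s z≤n) (ℕₚ.≤-refl ∷ ℕₚ.≤-refl ∷ u≤)
      (𝒞-cons (s≤s z≤n) (ℕₚ.≤-refl ∷ u≤)
        (𝒞-cons (s≤s z≤n) u≤ 𝒞π (u+1⋠ , u⋠ , u+2⋠ , u⋠ , u⋠))
        ((λ { (() ∷ _) }) , (λ { (_ ∷ p) → u+1⋠ p }) , (λ { (() ∷ _) })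
          , (λ { (_ ∷ p) → u⋠ p }) , (λ { (_ ∷ p) → u⋠ p })))
      ((λ { (() ∷ _) }) , (λ { (_ ∷ () ∷ _) }) , (λ { (() ∷ _) })
        , (λ { (_ ∷ _ ∷ p) → u+2⋠ p }) , (λ { (_ ∷ _ ∷ p) → u⋠ p }))
  , ℕₚ.≤-refl ∷ ℕₚ.≤-refl ∷ ℕₚ.≤-refl ∷ u≤
  where
  u≤ = weaken (ℕₚ.m≤n+m (2 + v) 3) u+3≤
  u⋠ : ∀ {ys} → ¬ (2 + v ∷ ys ≼ _)
  u⋠ = ≼-≥ u+3≤ (ℕₚ.m≤n+m _ 2)
  u+1⋠ : ∀ {ys} → ¬ (3 + v ∷ ys ≼ _)
  u+1⋠ = ≼-≥ u+3≤ (ℕₚ.n≤1+n _)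
  u+2⋠ : ∀ {ys} → ¬ (4 + v ∷ ys ≼ _)
  u+2⋠ = ≼-≥ u+3≤ ℕₚ.≤-refl

T∖S⇒T : ∀ {v π} → Admissible T∖S v π → Admissible T v π
T∖S⇒T (𝒞π , v+2≤) = 𝒞π , weaken (ℕₚ.n≤1+n _) v+2≤ , ≼-≥ v+2≤ ℕₚ.≤-refl

D⇒S : ∀ {v π} → Admissible D v π → Admissible S v π
D⇒S (𝒞π , v< , v³⋠) = 𝒞π , weaken (ℕₚ.n≤1+n _) v< , ≼-≥ v< ℕₚ.≤-refl , v³⋠

T⇒D : ∀ {v π} → Admissible T v π → Admissible D v π
T⇒D (𝒞π , v< , v²⋠) = 𝒞π , v< , λ { (p ∷ q ∷ _) → v²⋠ (p ∷ q ∷ []) }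

S⇒T : ∀ {v π} → Admissible S (1 + v) π → Admissible T v π
S⇒T (𝒞π , v< , v²⋠ , _) = 𝒞π , v< , v²⋠

D⇒T∖S : ∀ {v π} → Admissible D (1 + v) π → Admissible T∖S v π
D⇒T∖S (𝒞π , v+2≤ , _) = 𝒞π , v+2≤

gen-admissible : ∀ X f {v} → 1 ≤ v → All (Admissible X v) (gen X f v)
gen-admissible = state-induction (λ X f → ∀ {v} → 1 ≤ v → All (Admissible X v) (gen X f v)) base
  (λ f d s 1≤v → Allₚ.++⁺ (All.map D⇒S (d 1≤v)) (Allₚ.map⁺ (All.map (extend-S 1≤v) (s (s≤s z≤n)))))
  (λ f t d 1≤v → Allₚ.++⁺ (All.map T⇒D (t 1≤v)) (Allₚ.map⁺ (All.map extend-D (d (s≤s z≤n)))))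
  (λ f s t 1≤v → Allₚ.++⁺ (All.map S⇒T (s (s≤s z≤n)))
    (Allₚ.map⁺ (All.map (T∖S⇒T ∘ extend-T∖S) (t (s≤s z≤n)))))
  (λ f d t 1≤v → Allₚ.++⁺ (All.map D⇒T∖S (d (s≤s z≤n)))
    (Allₚ.map⁺ (All.map extend-T∖S (t (s≤s z≤n)))))
  where
  𝒞[] : 𝒞 []
  𝒞[] = ([] , []) , λ _ _ → (λ { (here ()) }) , (λ { (here ()) }) , (λ { (here ()) })
                           , (λ { (here ()) }) , (λ { (here ()) })
  allowed[] : ∀ X {v} → Allowed X v []
  allowed[] S   = [] , (λ ()) , λ ()
  allowed[] D   = [] , λ ()
  allowed[] T   = [] , λ ()
  allowed[] T∖S = []
  base : ∀ X {v} → 1 ≤ v → All (Admissible X v) (gen X 0 v)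
  base X {v} _ rewrite gen-zero X v = (𝒞[] , allowed[] X) ∷ []

strip-S : ∀ {v π} → Admissible S v (v ∷ π) → Admissible S (1 + v) π
strip-S (𝒞π , v≤ , v²⋠ , _) = let a , _ , c , _ = 𝒞-head 𝒞π in
  𝒞-tail 𝒞π , raise (𝒞-tail 𝒞π) (𝒞-all 𝒞π) (λ p → v²⋠ (refl ∷ p)) , a , c

strip-D : ∀ {v π} → Admissible D v (1 + v ∷ 1 + v ∷ π) → Admissible D (2 + v) π
strip-D (𝒞π , _ , v³⋠) =
  let 𝒞₁ = 𝒞-tail 𝒞π
      𝒞₂ = 𝒞-tail 𝒞₁
      _ , b , _ = 𝒞-head 𝒞π
      _ , _ , c , _ = 𝒞-head 𝒞₁
  in 𝒞₂ , raise 𝒞₂ (raise 𝒞₂ (𝒞-all 𝒞₁) (λ p → v³⋠ (refl ∷ refl ∷ p))) (λ p → b (refl ∷ p)) , c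

-- With u = v + 2, the patterns u u u u, u u (u + 1) and u u u (u + 2) exclude u, u + 1 and u + 2 in
-- turn as the next part. The last one is the forbidden pair Tᵥ, Sᵥ₊₁.
strip-T∖S : ∀ {v π} → 𝒞 (replicate 3 (2 + v) ++ π) → Admissible T∖S (3 + v) π
strip-T∖S 𝒞π =
  let 𝒞₁ = 𝒞-tail 𝒞π
      𝒞₂ = 𝒞-tail 𝒞₁
      𝒞₃ = 𝒞-tail 𝒞₂
      _ , _ , _ , d , e = 𝒞-head 𝒞π
      _ , b , _ = 𝒞-head 𝒞₁
  in 𝒞₃ , raise 𝒞₃ (raise 𝒞₃ (raise 𝒞₃ (𝒞-all 𝒞₂)
       (λ p → e (refl ∷ refl ∷ p))) (λ p → b (refl ∷ p))) (λ p → d (refl ∷ refl ∷ p))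

-- A spent unit of fuel raises the level by at least one, so fuel plus level never decreases.
later-level : ∀ {b} f v k → b ≤ suc f + v → b ≤ f + (suc k + v)
later-level f v k b≤ = ℕₚ.≤-trans b≤ (ℕₚ.≤-trans (ℕₚ.≤-reflexive (sym (ℕₚ.+-suc f v)))
  (ℕₚ.+-monoʳ-≤ f (s≤s (ℕₚ.m≤n+m v k))))

-- Whether the next run is a prefix of π decides which half of the list contains π. Without fuel,
-- all parts are at least v and below b ≤ v, so there are none.
admissible⇒∈gen : ∀ X f {v b π} → b ≤ f + v → All (_< b) π → Admissible X v π → π ∈ gen X f v
admissible⇒∈gen = state-induction Covers base step-S step-D step-T step-T∖S
  where
  Covers : State → ℕ → Set
  Covers X f = ∀ {v b π} → b ≤ f + v → All (_< b) π → Admissible X v π → π ∈ gen X f v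

  base : ∀ X → Covers X 0
  base X {v} b≤ <b (_ , allowed) rewrite gen-zero X v = here (empty <b (bound X allowed))
    where
    bound : ∀ X {π} → Allowed X v π → All (v ≤_) π
    bound S   (v≤ , _) = v≤
    bound D   (v< , _) = weaken (ℕₚ.n≤1+n v) v<
    bound T   (v< , _) = weaken (ℕₚ.n≤1+n v) v<
    bound T∖S v+2≤     = weaken (ℕₚ.m≤n+m v 2) v+2≤
    empty : ∀ {π} → All (_< _) π → All (v ≤_) π → π ≡ []
    empty []        []        = refl
    empty (x<b ∷ _) (v≤x ∷ _) = contradiction (ℕₚ.<-≤-trans x<b b≤) (ℕₚ.≤⇒≯ v≤x)

  step-S : ∀ f → Covers D (suc f) → Covers S f → Covers S (suc f)
  step-S f d s {v} {π = π} b≤ <b adm@(𝒞π , v≤ , _ , v³⋠) with prefix? _≟_ (v ∷ []) π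
  ... | no v⋠           = ∈-++⁺ˡ (d b≤ <b (𝒞π , raise 𝒞π v≤ v⋠ , v³⋠))
  ... | yes (refl ∷ []) = ∈-++⁺ʳ (genD (suc f) v)
    (∈-map⁺ _ (s (later-level f v 0 b≤) (All.tail <b) (strip-S adm)))

  step-D : ∀ f → Covers T (suc f) → Covers D f → Covers D (suc f)
  step-D f t d {v} {π = π} b≤ <b adm@(𝒞π , v< , _) with prefix? _≟_ (replicate 2 (1 + v)) π
  ... | no v²⋠                 = ∈-++⁺ˡ (t b≤ <b (𝒞π , v< , v²⋠))
  ... | yes (refl ∷ refl ∷ []) = ∈-++⁺ʳ (genT (suc f) v)
    (∈-map⁺ _ (d (later-level f v 1 b≤) (All.tail (All.tail <b)) (strip-D adm)))

  step-T : ∀ f → Covers S f → Covers T∖S f → Covers T (suc f)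
  step-T f s t {v} {π = π} b≤ <b (𝒞π , v< , v²⋠) with prefix? _≟_ (replicate 3 (2 + v)) π
  ... | no v³⋠                        = ∈-++⁺ˡ (s (later-level f v 0 b≤) <b (𝒞π , v< , v²⋠ , v³⋠))
  ... | yes (refl ∷ refl ∷ refl ∷ []) = ∈-++⁺ʳ (genS f (1 + v))
    (∈-map⁺ _ (t (later-level f v 2 b≤) (All.tail (All.tail (All.tail <b))) (strip-T∖S 𝒞π)))

  step-T∖S : ∀ f → Covers D f → Covers T∖S f → Covers T∖S (suc f)
  step-T∖S f d t {v} {π = π} b≤ <b (𝒞π , v+2≤) with prefix? _≟_ (replicate 3 (2 + v)) π
  ... | no v³⋠                        = ∈-++⁺ˡ (d (later-level f v 0 b≤) <b (𝒞π , v+2≤ , v³⋠))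
  ... | yes (refl ∷ refl ∷ refl ∷ []) = ∈-++⁺ʳ (genD f (1 + v))
    (∈-map⁺ _ (t (later-level f v 2 b≤) (All.tail (All.tail (All.tail <b))) (strip-T∖S 𝒞π)))

unique-++-map : ∀ {xs ys} p → Unique xs → Unique ys → All (λ π → ¬ p ≼ π) xs →
                Unique (xs ++ map (p ++_) ys)
unique-++-map {xs} {ys} p uxs uys p⋠ =
  Uniqueₚ.++⁺ uxs (Uniqueₚ.map⁺ (++-cancelˡ p _ _) uys) disjoint
  where
  ≼-++ : ∀ p {π} → p ≼ p ++ π
  ≼-++ []      = []
  ≼-++ (x ∷ p) = refl ∷ ≼-++ p
  disjoint : Disjoint xs (map (p ++_) ys)
  disjoint (π∈xs , π∈map) with ∈-map⁻ (p ++_) π∈map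
  ... | _ , _ , refl = All.lookup p⋠ π∈xs (≼-++ p)

-- The first half of each list is admissible for a state that excludes the run with which the second
-- half begins.
gen-unique : ∀ X f {v} → 1 ≤ v → Unique (gen X f v)
gen-unique = state-induction (λ X f → ∀ {v} → 1 ≤ v → Unique (gen X f v)) base
  (λ f d s {v} 1≤v → unique-++-map (replicate 1 v) (d 1≤v) (s (s≤s z≤n))
    (All.map (λ (_ , v< , _) → ≼-≥ v< ℕₚ.≤-refl) (gen-admissible D (suc f) 1≤v)))
  (λ f t d {v} 1≤v → unique-++-map (replicate 2 (1 + v)) (t 1≤v) (d (s≤s z≤n))
    (All.map (λ (_ , _ , v²⋠) → v²⋠) (gen-admissible T (suc f) 1≤v)))
  (λ f s t {v} 1≤v → unique-++-map (replicate 3 (2 + v)) (s (s≤s z≤n)) (t (s≤s z≤n))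
    (All.map (λ (_ , _ , _ , v³⋠) → v³⋠) (gen-admissible S f (s≤s z≤n))))
  (λ f d t {v} 1≤v → unique-++-map (replicate 3 (2 + v)) (d (s≤s z≤n)) (t (s≤s z≤n))
    (All.map (λ (_ , _ , v³⋠) → v³⋠) (gen-admissible D f (s≤s z≤n))))
  where
  base : ∀ X {v} → 1 ≤ v → Unique (gen X 0 v)
  base X {v} _ rewrite gen-zero X v = [] AllPairs.∷ AllPairs.[]

𝒫₇⇒S : ∀ {π} → 𝒫₇ π → Admissible S 1 π
𝒫₇⇒S (𝒞π , 11⋢ , 222⋢) = 𝒞π , proj₁ (proj₁ 𝒞π) , 11⋢ ∘ here , 222⋢ ∘ here

-- The state restricts only the front. A part before 1+1 is again 1, so 1+1 is also in front; a part
-- before 2+2+2 would give 2+2+2+2 or 1+2+2, both forbidden in `𝒞`.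
S⇒𝒫₇ : ∀ {π} → Admissible S 1 π → 𝒫₇ π
S⇒𝒫₇ (𝒞π , _ , 11⋠ , 222⋠) = 𝒞π , 11⋠ ∘ initial₁ 𝒞π , 222⋠ ∘ initial₂ 𝒞π
  where
  initial₁ : ∀ {π} → 𝒞 π → 1 ∷ 1 ∷ [] ⊑ π → replicate 2 1 ≼ π
  initial₁ 𝒞π (here p)  = p
  initial₁ 𝒞π@((1≤x ∷ _ , _) , _) (there q) with initial₁ (𝒞-tail 𝒞π) q | 𝒞-all 𝒞π
  ... | refl ∷ _ | x≤1 ∷ _ = ℕₚ.≤-antisym 1≤x x≤1 ∷ refl ∷ []
  initial₂ : ∀ {π} → 𝒞 π → 2 ∷ 2 ∷ 2 ∷ [] ⊑ π → replicate 3 2 ≼ π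
  initial₂ 𝒞π (here p)  = p
  initial₂ 𝒞π@((1≤x ∷ _ , _) , _) (there q) with initial₂ (𝒞-tail 𝒞π) q | 𝒞-all 𝒞π
  ... | p@(refl ∷ refl ∷ _) | x≤2 ∷ _ with ℕₚ.m≤n⇒m<n∨m≡n x≤2
  ...   | inj₂ refl = contradiction p (proj₂ (proj₂ (proj₂ (proj₂ (𝒞-head 𝒞π)))))
  ...   | inj₁ (s≤s x≤1) with refl ← ℕₚ.≤-antisym x≤1 1≤x =
    contradiction (refl ∷ refl ∷ []) (proj₁ (𝒞-head 𝒞π))

-- Comparison of the recurrences

∑-upTo-head : ∀ N (f : ℕ → ℤ) → (∀ i → f (suc i) ≡ 0ℤ) → ∑ (upTo (suc N)) f ≡ f 0
∑-upTo-head N f p = begin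
  f 0 ℤ.+ ∑ (applyUpTo suc N) f  ≡⟨ cong (λ zs → f 0 ℤ.+ sumℤ zs) (map-applyUpTo suc f N) ⟩
  f 0 ℤ.+ sumℤ (applyUpTo (f ∘ suc) N) ≡⟨ cong (λ zs → f 0 ℤ.+ sumℤ zs) (map-upTo (f ∘ suc) N) ⟨
  f 0 ℤ.+ ∑ (upTo N) (f ∘ suc)   ≡⟨ cong (ℤ._+_ (f 0)) (∑-zero (upTo N) p) ⟩
  f 0 ℤ.+ 0ℤ                     ≡⟨ ℤₚ.+-identityʳ (f 0) ⟩
  f 0                            ∎
  where open ≡-Reasoning

∑-×-head : ∀ {A : Set} N (ys : List A) (f : ℕ × A → ℤ) → (∀ i y → f (suc i , y) ≡ 0ℤ) →
           ∑ (cartesianProduct (upTo (suc N)) ys) f ≡ ∑ ys (λ y → f (0 , y))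
∑-×-head N ys f p =
  trans (∑-× (upTo (suc N)) ys f) (∑-upTo-head N (λ i → ∑ ys (λ y → f (i , y))) (λ i → ∑-zero ys (p i)))

term-small : ∀ p x m {n} → n < expo p x → term p x m n ≡ 0ℤ
term-small p x m {n} n<E = x^-zero (weight x) (sign x · q^ expo p x ⊘ den x) m n (begin
  (sign x · q^ expo p x ⊘ den x) n           ≡⟨ ⊘-monomial (sign x) (expo p x) (den x) n ⟩
  sign x ℤ.* shift (expo p x) (recip (den x)) n ≡⟨ cong (ℤ._*_ (sign x)) (shift-< (recip (den x)) n<E) ⟩
  sign x ℤ.* 0ℤ                              ≡⟨ ℤₚ.*-zeroʳ (sign x) ⟩
  0ℤ                                         ∎)
  where open ≡-Reasoning

term-0 : ∀ p → let o = 0 , 0 , 0 , 0 in ∀ m n → term p o m n ≡ (x^ 0 · q^ 0) m n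
term-0 p@(α , β , γ , δ) = x^-cong refl λ n → begin
  (1ℤ · q^ expo p o ⊘ den o) n         ≡⟨ ⊘-monomial 1ℤ (expo p o) (den o) n ⟩
  1ℤ ℤ.* shift (expo p o) (recip (den o)) n ≡⟨ ℤₚ.*-identityˡ _ ⟩
  shift (expo p o) (recip (den o)) n   ≡⟨ cong (λ e → shift e (recip (den o)) n) (expo≡0 α β γ δ) ⟩
  recip (den o) n                      ≡⟨ identityˡ (recip (den o)) n ⟨
  (one ⊛ recip (den o)) n              ≡⟨ ⊛-cong {g = recip (den o)} den≗one (λ _ → refl) n ⟨
  (den o ⊛ recip (den o)) n            ≡⟨ ⊛-recip (den o) (den-const o) n ⟩
  one n                                ∎
  where
  open ≡-Reasoning
  o = 0 , 0 , 0 , 0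
  expo≡0 : ∀ α β γ δ → 0 + α * 0 + β * 0 + γ * 0 + δ * 0 ≡ 0
  expo≡0 = solve-∀
  den≗one : den o ≗ one
  den≗one n = trans (⊛-cong {g = one} (λ k → trans (⊛-cong {g = one} (identityˡ one) (λ _ → refl) k)
    (identityˡ one k)) (λ _ → refl) n) (identityˡ one n)

≤-expo : ∀ α β γ δ i j k l → let E = expo (α , β , γ , δ) (i , j , k , l) in
         α * i ≤ E × β * j ≤ E × γ * k ≤ E × δ * l ≤ E
≤-expo α β γ δ i j k l =
    ≤-trans (≤-trans (≤-trans (m≤n+m a A) (m≤m+n (A + a) b)) (m≤m+n (A + a + b) c)) (m≤m+n (A + a + b + c) d)
  , ≤-trans (≤-trans (m≤n+m b (A + a)) (m≤m+n (A + a + b) c)) (m≤m+n (A + a + b + c) d)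
  , ≤-trans (m≤n+m c (A + a + b)) (m≤m+n (A + a + b + c) d)
  , m≤n+m d (A + a + b + c)
  where
  open ℕₚ
  A = tri (weight (i , j , k , l)) + 2 * l ^ 2
  a = α * i
  b = β * j
  c = γ * k
  d = δ * l

-- A nonzero index costs an exponent of at least v, so below qᵛ only the term with all indices 0 is
-- left.
Φ-small : ∀ {v α β γ δ N m n} → v ≤ α → v ≤ β → v ≤ γ → v ≤ δ → n < v → m < N →
          Φ N (α , β , γ , δ) m n ≡ (x^ 0 · q^ 0) m n
Φ-small {v} {α} {β} {γ} {δ} {suc N} {m} {n} v≤α v≤β v≤γ v≤δ n<v _ = begin
  ∑ (quads (suc N)) (λ x → term p x m n)
    ≡⟨ ∑-×-head N Q₃ (λ x → term p x m n) (λ { i y@(j , k , l) → small (suc i , y) v≤α i (proj₁ (≤-expo α β γ δ (suc i) j k l)) }) ⟩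
  ∑ Q₃ (λ y → term p (0 , y) m n)
    ≡⟨ ∑-×-head N Q₂ (λ y → term p (0 , y) m n) (λ { j y@(k , l) → small (0 , suc j , y) v≤β j (proj₁ (proj₂ (≤-expo α β γ δ 0 (suc j) k l))) }) ⟩
  ∑ Q₂ (λ y → term p (0 , 0 , y) m n)
    ≡⟨ ∑-×-head N (upTo (suc N)) (λ y → term p (0 , 0 , y) m n) (λ k l →
         small (0 , 0 , suc k , l) v≤γ k (proj₁ (proj₂ (proj₂ (≤-expo α β γ δ 0 0 (suc k) l))))) ⟩
  ∑ (upTo (suc N)) (λ l → term p (0 , 0 , 0 , l) m n)
    ≡⟨ ∑-upTo-head N (λ l → term p (0 , 0 , 0 , l) m n) (λ l → small (0 , 0 , 0 , suc l) v≤δ l (proj₂ (proj₂ (proj₂ (≤-expo α β γ δ 0 0 0 (suc l)))))) ⟩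
  term p (0 , 0 , 0 , 0) m n
    ≡⟨ term-0 p m n ⟩
  (x^ 0 · q^ 0) m n ∎
  where
  open ≡-Reasoning
  p  = α , β , γ , δ
  Q₂ = cartesianProduct (upTo (suc N)) (upTo (suc N))
  Q₃ = cartesianProduct (upTo (suc N)) Q₂
  small : ∀ {a} x → v ≤ a → ∀ i → a * suc i ≤ expo p x → term p x m n ≡ 0ℤ
  small {a} x v≤a i a*i≤E = term-small p x m
    (ℕₚ.<-≤-trans n<v (ℕₚ.≤-trans v≤a (ℕₚ.≤-trans (ℕₚ.m≤m*n a (suc i)) a*i≤E)))

-- The weights v, 2v+1, 3v+3 and 4v+4 of Sᵥ, Dᵥ, Tᵥ and the pair Tᵥ Sᵥ₊₁, moved up
-- where the state excludes the first of them; the last weight appears lowered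
-- by 2 because the exponent contains 2l² = 4 l(l-1)/2 + 2l.
params : State → ℕ → Quad
params S   v = v     , v * 2 + 1       , v * 3 + 3 , v * 4 + 2
params D   v = 1 + v , v * 2 + 1       , v * 3 + 3 , v * 4 + 2
params T   v = 1 + v , 2 + (v * 2 + 1) , v * 3 + 3 , v * 4 + 2
params T∖S v = 2 + v , 2 + (v * 2 + 1) , v * 3 + 3 , 4 + (v * 4 + 2)

module _ {N m : ℕ} (m<N : m < N) (n v : ℕ) where

  private
    φ : State → ℕ → ℤ⟦x,q⟧
    φ X v = Φ N (params X v)

    exponent : ∀ {c} p₁ p₂ w {e e′} → e ≡ e′ →
      c ≡ Φ N p₁ m n ℤ.+ shift₂ w e (Φ N p₂) m n → c ≡ Φ N p₁ m n ℤ.+ shift₂ w e′ (Φ N p₂) m n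
    exponent _ _ _ refl eq = eq

  -- The parameters produced by `Φ-α` are those of the next state by computation, since `suc v * 2`
  -- unfolds to `2 + v * 2`. Only the shift is rewritten, as number of parts times part, to match
  -- `∑-block`.
  Φ-S : φ S v m n ≡ φ D v m n ℤ.+ shift₂ 1 (1 * v) (φ S (1 + v)) m n
  Φ-S = exponent (params D v) (params S (1 + v)) 1 (sym (ℕₚ.*-identityˡ v))
    (Φ-α v (v * 2 + 1) (v * 3 + 3) (v * 4 + 2) m<N n)

  Φ-D : φ D v m n ≡ φ T v m n ℤ.+ shift₂ 2 (2 * (1 + v)) (φ D (2 + v)) m n
  Φ-D = exponent (params T v) (params D (2 + v)) 2 (lemma v)
    (Φ-β (1 + v) (v * 2 + 1) (v * 3 + 3) (v * 4 + 2) m<N n)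
    where
    lemma : ∀ v → 1 + (v * 2 + 1) ≡ 2 * (1 + v)
    lemma = solve-∀

  Φ-T∖S : φ T∖S v m n ≡ φ D (1 + v) m n ℤ.+ shift₂ 3 (3 * (2 + v)) (φ T∖S (3 + v)) m n
  Φ-T∖S = exponent (params D (1 + v)) (params T∖S (3 + v)) 3 (lemma v)
    (Φ-γ (2 + v) (2 + (v * 2 + 1)) (v * 3 + 3) (4 + (v * 4 + 2)) m<N n)
    where
    lemma : ∀ v → 3 + (v * 3 + 3) ≡ 3 * (2 + v)
    lemma = solve-∀

  -- This is the identity 1 - Tᵥ Sᵥ₊₁ = (1 - Tᵥ) + Tᵥ (1 - Sᵥ₊₁).
  Φ-T : φ T v m n ≡ φ S (1 + v) m n ℤ.+ shift₂ 3 (3 * (2 + v)) (φ T∖S (3 + v)) m n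
  -- Z stands for the pair Tᵥ Sᵥ₊₁ followed by the rest. On the left `Φ-δ` absorbs it; on the right
  -- it is what remains after taking out Tᵥ by `Φ-γ` and Sᵥ₊₁ by `Φ-α`.
  Φ-T = +-cancelʳ Z _ _ (begin
    φ T v m n ℤ.+ Z
      ≡⟨ Φ-δ α β γ δ m<N n ⟨
    Φ N (α , β , γ , 4 + δ) m n
      ≡⟨ Φ-γ α β γ (4 + δ) m<N n ⟩
    φ S (1 + v) m n ℤ.+ shift₂ 3 (3 + γ) (Φ N (3 + α , 6 + β , 9 + γ , 16 + δ)) m n
      ≡⟨ cong (ℤ._+_ (φ S (1 + v) m n)) (shift₂-cong 3 (3 + γ) m n λ m′ n′ 3+m′≡m _ →
           Φ-α (3 + α) (6 + β) (9 + γ) (16 + δ)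
             (ℕₚ.≤-<-trans (ℕₚ.≤-trans (ℕₚ.m≤n+m m′ 3) (ℕₚ.≤-reflexive 3+m′≡m)) m<N) n′) ⟩
    φ S (1 + v) m n ℤ.+ shift₂ 3 (3 + γ) (λ m n → φ T∖S (3 + v) m n ℤ.+ shift₂ 1 (3 + α) R m n) m n
      ≡⟨ cong (ℤ._+_ (φ S (1 + v) m n)) (shift₂-+ 3 (3 + γ) (φ T∖S (3 + v)) (shift₂ 1 (3 + α) R) m n) ⟩
    φ S (1 + v) m n ℤ.+ (Y (3 + γ) ℤ.+ shift₂ 3 (3 + γ) (shift₂ 1 (3 + α) R) m n)
      ≡⟨ cong₂ (λ y z → φ S (1 + v) m n ℤ.+ (y ℤ.+ z)) (cong Y (lemma₁ v))
           (trans (shift₂-shift₂ 3 (3 + γ) 1 (3 + α) R m n) (cong (λ e → shift₂ 4 e R m n) (lemma₂ v))) ⟩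
    φ S (1 + v) m n ℤ.+ (Y (3 * (2 + v)) ℤ.+ Z)
      ≡⟨ ℤₚ.+-assoc (φ S (1 + v) m n) (Y (3 * (2 + v))) Z ⟨
    φ S (1 + v) m n ℤ.+ Y (3 * (2 + v)) ℤ.+ Z ∎)
    where
    open ≡-Reasoning
    α = 1 + v
    β = 2 + (v * 2 + 1)
    γ = v * 3 + 3
    δ = v * 4 + 2
    R = Φ N (4 + α , 8 + β , 12 + γ , 20 + δ)
    Y : ℕ → ℤ
    Y e = shift₂ 3 e (φ T∖S (3 + v)) m n
    Z = shift₂ 4 (8 + δ) R m n
    lemma₁ : ∀ v → 3 + (v * 3 + 3) ≡ 3 * (2 + v)
    lemma₁ = solve-∀
    lemma₂ : ∀ v → 3 + (v * 3 + 3) + (3 + (1 + v)) ≡ 8 + (v * 4 + 2)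
    lemma₂ = solve-∀

monomial : List ℕ → ℤ⟦x,q⟧
monomial π = x^ length π · q^ sum π

sum-replicate : ∀ w p → sum (replicate w p) ≡ w * p
sum-replicate zero    p = refl
sum-replicate (suc w) p = cong (p +_) (sum-replicate w p)

∑-block : ∀ w p πs m n → ∑ (map (replicate w p ++_) πs) (λ π → monomial π m n)
        ≡ shift₂ w (w * p) (λ m n → ∑ πs (λ π → monomial π m n)) m n
∑-block w p πs m n = begin
  sumℤ (map (λ π → monomial π m n) (map (replicate w p ++_) πs)) ≡⟨ cong sumℤ (map-∘ πs) ⟨
  ∑ πs (λ π → monomial (replicate w p ++ π) m n)                 ≡⟨ ∑-cong πs block ⟩
  ∑ πs (λ π → shift₂ w (w * p) (monomial π) m n)
    ≡⟨ shift₂-∑ w (w * p) πs monomial m n ⟨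
  shift₂ w (w * p) (λ m n → ∑ πs (λ π → monomial π m n)) m n     ∎
  where
  open ≡-Reasoning
  block : ∀ π → monomial (replicate w p ++ π) m n ≡ shift₂ w (w * p) (monomial π) m n
  block π = trans
    (x^-cong (trans (length-++ (replicate w p)) (cong (_+ length π) (length-replicate w)))
      (λ k → trans
        (cong (λ e → (q^ e) k) (trans (sum-++ (replicate w p) π) (cong (_+ sum π) (sum-replicate w p))))
        (sym (q^-shift (w * p) (sum π) k))) m n)
    (sym (shift₂-x^ w (w * p) (length π) (q^ sum π) m n))

module _ {N : ℕ} where

  -- A partition with a part of size f + v or more has a larger sum than n, so the truncation by
  -- fuel does not show. N is fixed while m and n go down in the recurrences.
  Counts : State → ℕ → Set
  Counts X f = ∀ {v m n} → m < N → n < f + v → ∑ (gen X f v) (λ π → monomial π m n) ≡ Φ N (params X v) m n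

  gen-counts : ∀ X f → Counts X f
  gen-counts = state-induction Counts base
    (λ f d s {v} {n = n} m< n< → step f v 0 m< n< (genD (suc f) v) 1 v S s (d m< n<) (Φ-S m< n v))
    (λ f t d {v} {n = n} m< n< → step f v 1 m< n< (genT (suc f) v) 2 (1 + v) D d (t m< n<) (Φ-D m< n v))
    (λ f s t {v} {n = n} m< n< → step f v 2 m< n< (genS f (1 + v)) 3 (2 + v) T∖S t
      (s m< (later-level f v 0 n<)) (Φ-T m< n v))
    (λ f d t {v} {n = n} m< n< → step f v 2 m< n< (genD f (1 + v)) 3 (2 + v) T∖S t
      (d m< (later-level f v 0 n<)) (Φ-T∖S m< n v))
    where
    base : ∀ X → Counts X 0
    base X {v} {m} {n} m<N n<v rewrite gen-zero X v =
      trans (ℤₚ.+-identityʳ _) (sym (small X))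
      where
      v≤v*[1+k]+j : ∀ k j → v ≤ v * suc k + j
      v≤v*[1+k]+j k j = ℕₚ.≤-trans (ℕₚ.m≤m*n v (suc k)) (ℕₚ.m≤m+n _ j)
      v≤β = v≤v*[1+k]+j 1 1
      v≤γ = v≤v*[1+k]+j 2 3
      v≤δ = v≤v*[1+k]+j 3 2
      +≤ : ∀ {a} k → v ≤ a → v ≤ k + a
      +≤ k v≤a = ℕₚ.≤-trans v≤a (ℕₚ.m≤n+m _ k)
      small : ∀ X → Φ N (params X v) m n ≡ (x^ 0 · q^ 0) m n
      small S   = Φ-small ℕₚ.≤-refl v≤β v≤γ v≤δ n<v m<N
      small D   = Φ-small (+≤ 1 ℕₚ.≤-refl) v≤β v≤γ v≤δ n<v m<N
      small T   = Φ-small (+≤ 1 ℕₚ.≤-refl) (+≤ 2 v≤β) v≤γ v≤δ n<v m<N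
      small T∖S = Φ-small (+≤ 2 ℕₚ.≤-refl) (+≤ 2 v≤β) v≤γ (+≤ 4 v≤δ) n<v m<N

    -- Common to the four states: w equal parts p are put in front and the level rises by `suc k`.
    step : ∀ f v k {m n} → m < N → n < suc f + v → ∀ xs w p X → Counts X f → ∀ {c c₁} →
           ∑ xs (λ π → monomial π m n) ≡ c₁ →
           c ≡ c₁ ℤ.+ shift₂ w (w * p) (Φ N (params X (suc k + v))) m n →
           ∑ (xs ++ map (replicate w p ++_) (gen X f (suc k + v))) (λ π → monomial π m n) ≡ c
    step f v k {m} {n} m<N n< xs w p X counts {c} {c₁} xs≡ c≡ = begin
      ∑ (xs ++ map (replicate w p ++_) ys) (λ π → monomial π m n)
        ≡⟨ ∑-++ xs _ _ ⟩
      ∑ xs (λ π → monomial π m n) ℤ.+ ∑ (map (replicate w p ++_) ys) (λ π → monomial π m n)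
        ≡⟨ cong₂ ℤ._+_ xs≡ (trans (∑-block w p ys m n) (shift₂-cong w (w * p) m n
             (λ m′ n′ w+m′≡m e+n′≡n → counts
               (ℕₚ.≤-<-trans (ℕₚ.≤-trans (ℕₚ.m≤n+m m′ w) (ℕₚ.≤-reflexive w+m′≡m)) m<N)
               (later-level f v k (ℕₚ.≤-<-trans
                 (ℕₚ.≤-trans (ℕₚ.m≤n+m n′ (w * p)) (ℕₚ.≤-reflexive e+n′≡n)) n<))))) ⟩
      c₁ ℤ.+ shift₂ w (w * p) (Φ N (params X (suc k + v))) m n
        ≡⟨ c≡ ⟨
      c ∎
      where
      open ≡-Reasoning
      ys = gen X f (suc k + v)

-- The two formal sums

parts≤sum : ∀ π → All (_≤ sum π) π
parts≤sum []      = []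
parts≤sum (x ∷ π) = ℕₚ.m≤m+n x (sum π) ∷ All.map (λ y≤ → ℕₚ.≤-trans y≤ (ℕₚ.m≤n+m _ x)) (parts≤sum π)

-- The box grows with m: side m + 1 has room for all indices of weight m.
Series : Quad → ℤ⟦x,q⟧
Series p m = Φ (suc m) p m

HasSum-gen : ∀ X (P : List ℕ → Set) → (∀ {π} → P π → Admissible X 1 π) →
             (∀ {π} → Admissible X 1 π → P π) → HasSum P monomial (Series (params X 1))
HasSum-gen X P P⇒X X⇒P m n =
    -- Fuel n at level 1 reaches all parts below n + 1, hence all partitions of n.
    gen X n 1
  , gen-unique X n ℕₚ.≤-refl
  , All.map X⇒P (gen-admissible X n ℕₚ.≤-refl)
  , covers
  , gen-counts X n (ℕₚ.n<1+n m) n<n+1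
  where
  n<n+1 = ℕₚ.≤-reflexive (sym (ℕₚ.+-comm n 1))
  covers : ∀ π → P π → monomial π m n ≢ 0ℤ → π ∈ gen X n 1
  covers π Pπ ≢0 with n ≟ sum π
  ... | yes refl = admissible⇒∈gen X n n<n+1 (All.map s≤s (parts≤sum π)) (P⇒X Pπ)
  ... | no n≢sum = contradiction (x^-zero (length π) (q^ sum π) m n (q^-≢ {sum π} n≢sum)) ≢0

HasSum-quads : ∀ p → HasSum U (term p) (Series p)
HasSum-quads p m n =
    quads (suc m)
  , Uniqueₚ.cartesianProduct⁺ u (Uniqueₚ.cartesianProduct⁺ u (Uniqueₚ.cartesianProduct⁺ u u))
  , All.universal _ (quads (suc m))
  , covers
  , refl
  where
  u = Uniqueₚ.upTo⁺ (suc m)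
  covers : ∀ x → U x → term p x m n ≢ 0ℤ → x ∈ quads (suc m)
  covers x@(i , j , k , l) _ ≢0 with m ≟ weight x
  ... | no m≢M   = contradiction (x^-≢ (sign x · q^ expo p x ⊘ den x) n m≢M) ≢0
  ... | yes refl =
    let i≤ , j≤ , k≤ , l≤ = ≤-weight i j k l in
    ∈-cartesianProduct⁺ (∈-upTo⁺ (s≤s i≤)) (∈-cartesianProduct⁺ (∈-upTo⁺ (s≤s j≤))
      (∈-cartesianProduct⁺ (∈-upTo⁺ (s≤s k≤)) (∈-upTo⁺ (s≤s l≤))))

HasSum-cong : ∀ {I : Set} {P : I → Set} {F G : I → ℤ⟦x,q⟧} {S : ℤ⟦x,q⟧} →
              (∀ i m n → F i m n ≡ G i m n) → HasSum P F S → HasSum P G S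
HasSum-cong {F = F} {G} F≡G hF m n with hF m n
... | is , unique , all , covers , eq =
  is , unique , all , (λ i Pi ≢0 → covers i Pi (≢0 ∘ trans (sym (F≡G i m n))))
     , trans (sym (∑-cong is (λ i → F≡G i m n))) eq

mainTheorem10 : (∃ λ S →
    HasSum 𝒫₇ (λ π → x^ length π · q^ sum π) S
    × HasSum {ℕ × ℕ × ℕ × ℕ} U
    (λ (i , j , k , l) →
    let M = i + 2 * j + 3 * k + 4 * l in
    x^ M · ((-1ℤ ^ℤ l) · q^ (M * (M ∸ 1) / 2 + 2 * l ^ 2 + i + 3 * j + 6 * k + 6 * l)
    ⊘ (poch (q^ 1) (q^ 1) i ⊛ poch (q^ 2) (q^ 2) j
    ⊛ poch (q^ 3) (q^ 3) k ⊛ poch (q^ 4) (q^ 4) l)))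
    S)
    × (∃ λ S →
    HasSum 𝒫₇ₐ (λ π → x^ length π · q^ sum π) S
    × HasSum {ℕ × ℕ × ℕ × ℕ} U
    (λ (i , j , k , l) →
    let M = i + 2 * j + 3 * k + 4 * l in
    x^ M · ((-1ℤ ^ℤ l) · q^ (M * (M ∸ 1) / 2 + 2 * l ^ 2 + 3 * i + 5 * j + 6 * k + 10 * l)
    ⊘ (poch (q^ 1) (q^ 1) i ⊛ poch (q^ 2) (q^ 2) j
    ⊛ poch (q^ 3) (q^ 3) k ⊛ poch (q^ 4) (q^ 4) l)))
    S)
mainTheorem10 =
    ( Series (params S 1)
    , HasSum-gen S 𝒫₇ 𝒫₇⇒S S⇒𝒫₇
    , HasSum-cong
        -- `expo` has `1 * i` where the statement has `i`.
        (λ { x@(i , j , k , l) m n → cong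
          (λ i′ → (x^ weight x · (sign x
            · q^ (tri (weight x) + 2 * l ^ 2 + i′ + 3 * j + 6 * k + 6 * l) ⊘ den x)) m n)
          (ℕₚ.*-identityˡ i) })
        (HasSum-quads (params S 1)))
  , ( Series (params T∖S 1)
    -- By computation, `Admissible T∖S 1` is `𝒫₇ₐ` and the parameters are (3, 5, 6, 10).
    , HasSum-gen T∖S 𝒫₇ₐ id id
    , HasSum-quads (params T∖S 1))
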